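{- Let $G$ be a fixed $3$-uniform hypergraph with at least two edges. Then, as $q\to\infty$: (a) If $G \in \mathcal{U}_0$ (i.e. $G$ is tripartite), then $r(G;q) = q^{\Theta(1)}$. (b) If $G \in \mathcal{U}\setminus \mathcal{U}_0$, then $2^{\Omega(q)} \le r(G;q) \le 2^{q^{O(1)}}$. More precisely, if $G \in \mathcal{U}_\ell$, then $r(G;q) \le 2^{O(q^\ell \log q)}$. (c) If $G \notin \mathcal{U}$, then $2^{2^{q/2}} \le r(G;q) \le 2^{2^{O(q\log q)}}$. (Implicit constants depend on $G$.)
   Context: For a $3$-uniform hypergraph ($3$-graph) $G$ and a positive integer $q$, the Ramsey number $r(G;q)$ is the minimum positive integer $N$ such that every coloring of the edges of the complete $3$-graph $K_N^{(3)}$ with $q$ colors contains a monochromatic copy of $G$ (a copy is a subgraph isomorphic to $G$). A $3$-graph is tripartite if its vertex set can be partitioned into three parts such that every edge has exactly one vertex in each part. Collapsing: for a $3$-graph $G$, a set $U\subseteq V(G)$ with $2\le |U|<|V(G)|$ is collapsible if no edge of $G$ intersects $U$ in exactly two vertices. Given such $U$, let $v^*$ be a new vertex and let $H$ be the $3$-graph with vertex set $(V(G)\setminus U)\cup\{v^*\}$ and edge set $\{e\in E(G): e\cap U=\emptyset\}\cup\{xyv^*: \exists u\in U,\ xyu\in E(G)\}$. Then $H$ is obtained from $G$ by collapsing $U$, and $G$ is said to be reducible to the pair $(H, G[U])$, where $G[U]$ is the induced subhypergraph on $U$. The classes $\mathcal{U}_0\subseteq \mathcal{U}_1\subseteq\cdots$: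 $\mathcal{U}_0$ is the set of all tripartite $3$-graphs; $\mathcal{U}_1$ is the set of $3$-graphs $G$ having a vertex subset $S$ such that every edge of $G$ intersects $S$ in exactly one vertex; for $i>1$, $\mathcal{U}_i$ consists of $\mathcal{U}_{i-1}$ together with every $3$-graph $G$ that is reducible to some pair $(H,F)$ with $H\in\mathcal{U}_{i-1}$ and $F\in\mathcal{U}_i$ (this is well defined by induction on the number of vertices, since $v(H),v(F)<v(G)$). Finally $\mathcal{U}=\bigcup_{i\ge 0}\mathcal{U}_i$. -}

module Defs where

open import Data.Nat using (ℕ; zero; suc; _+_; _*_; _^_; _≤_; _<_)
open import Data.Nat.Logarithm using (⌊log₂_⌋)
open import Data.Bool using (Bool; true; false)
open import Data.Fin using (Fin)
open import Data.Fin.Subset using (Subset; _∈_; _∉_; ∣_∣)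
open import Data.Vec using (lookup)
open import Data.Product using (Σ; ∃; _×_; _,_)
open import Data.Sum using (_⊎_)
open import Relation.Nullary using (¬_)
open import Relation.Binary.PropositionalEquality using (_≡_; _≢_)
open import Function.Definitions using (Injective; Surjective)

-- 3-uniform hypergraphs on the vertex set Fin V.
-- The edge set is given by a symmetric Bool-valued function on triples
-- which is false whenever two entries coincide; the 3-set {x,y,z} is an
-- edge iff E x y z ≡ true.

record 3Graph : Set where
  field
    V        : ℕ
    E        : Fin V → Fin V → Fin V → Bool
    sym₁₂    : ∀ x y z → E x y z ≡ E y x z
    sym₂₃    : ∀ x y z → E x y z ≡ E x z y
    loopless : ∀ x y → E x x y ≡ false

open 3Graph public

Edge : (G : 3Graph) → Fin (V G) → Fin (V G) → Fin (V G) → Set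
Edge G x y z = E G x y z ≡ true

AtLeastTwoEdges : 3Graph → Set
AtLeastTwoEdges G = Σ (Fin (V G)) λ x → Σ (Fin (V G)) λ y → Σ (Fin (V G)) λ z →
  Σ (Fin (V G)) λ a → Σ (Fin (V G)) λ b → Σ (Fin (V G)) λ c →
  Edge G x y z × Edge G a b c × ¬ (a ≡ x ⊎ a ≡ y ⊎ a ≡ z)

-- A q-colouring of the edges of K_N^(3): a symmetric function on triples
-- (values on triples with repeated entries are irrelevant).
record Colouring (N q : ℕ) : Set where
  field
    col   : Fin N → Fin N → Fin N → Fin q
    csym₁₂ : ∀ x y z → col x y z ≡ col y x z
    csym₂₃ : ∀ x y z → col x y z ≡ col x z y

open Colouring public

MonoCopy : (G : 3Graph) {N q : ℕ} → Colouring N q → Fin q → Set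
MonoCopy G c i = Σ (Fin (V G) → Fin _) λ φ → Injective _≡_ _≡_ φ ×
  (∀ x y z → Edge G x y z → col c (φ x) (φ y) (φ z) ≡ i)

Arrows : 3Graph → ℕ → ℕ → Set
Arrows G q N = (c : Colouring N q) → Σ (Fin q) λ i → MonoCopy G c i

IsRamseyNumber : 3Graph → ℕ → ℕ → Set
IsRamseyNumber G q N = 1 ≤ N × Arrows G q N ×
  (∀ M → 1 ≤ M → M < N → ¬ Arrows G q M)

Tripartite : 3Graph → Set
Tripartite G = Σ (Fin (V G) → Fin 3) λ part → ∀ x y z → Edge G x y z →
  part x ≢ part y × part y ≢ part z × part x ≢ part z

inU : ∀ {n} → Subset n → Fin n → ℕ
inU U x with lookup U x
... | true  = 1
... | false = 0

meet : ∀ {n} → Subset n → Fin n → Fin n → Fin n → ℕ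
meet U x y z = inU U x + inU U y + inU U z

OneTransversal : 3Graph → Set
OneTransversal G = Σ (Subset (V G)) λ S → ∀ x y z → Edge G x y z → meet S x y z ≡ 1

Collapsible : (G : 3Graph) → Subset (V G) → Set
Collapsible G U = 2 ≤ ∣ U ∣ × ∣ U ∣ < V G ×
  (∀ x y z → Edge G x y z → meet U x y z ≢ 2)

-- H is (isomorphic to) the 3-graph obtained from G by collapsing U:
-- π identifies exactly the vertices of U into one new vertex v* and is
-- otherwise a bijection V(G)∖U → V(H)∖{v*}; the edges of H are exactly
-- the images of the edges of G not contained in U.
IsCollapse : (G : 3Graph) → Subset (V G) → 3Graph → Set
IsCollapse G U H = Σ (Fin (V G) → Fin (V H)) λ π →
  Surjective _≡_ _≡_ π ×
  (∀ x y → x ∉ U → y ∉ U → π x ≡ π y → x ≡ y) ×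
  (∀ u u′ → u ∈ U → u′ ∈ U → π u ≡ π u′) ×
  (∀ x u → x ∉ U → u ∈ U → π x ≢ π u) ×
  (∀ a b c → Edge H a b c →
     Σ (Fin (V G)) λ x → Σ (Fin (V G)) λ y → Σ (Fin (V G)) λ z →
       Edge G x y z × meet U x y z ≢ 3 × π x ≡ a × π y ≡ b × π z ≡ c) ×
  (∀ x y z → Edge G x y z → meet U x y z ≢ 3 → Edge H (π x) (π y) (π z))

IsInduced : (G : 3Graph) → Subset (V G) → 3Graph → Set
IsInduced G U F = Σ (Fin (V F) → Fin (V G)) λ ι →
  Injective _≡_ _≡_ ι ×
  (∀ j → ι j ∈ U) ×
  (∀ x → x ∈ U → Σ (Fin (V F)) λ j → ι j ≡ x) ×
  (∀ a b c → E F a b c ≡ E G (ι a) (ι b) (ι c))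

Reducible : 3Graph → 3Graph → 3Graph → Set
Reducible G H F = Σ (Subset (V G)) λ U →
  Collapsible G U × IsCollapse G U H × IsInduced G U F

data InU : ℕ → 3Graph → Set where
  tri   : ∀ {G} → Tripartite G → InU 0 G
  trans : ∀ {G} → OneTransversal G → InU 1 G
  up    : ∀ {i G} → InU (suc i) G → InU (suc (suc i)) G
  red   : ∀ {i G H F} → Reducible G H F → InU (suc i) H →
          InU (suc (suc i)) F → InU (suc (suc i)) G

InUAny : 3Graph → Set
InUAny G = Σ ℕ λ i → InU i G

Eventually : (ℕ → Set) → Set
Eventually P = Σ ℕ λ q₀ → ∀ q → q₀ ≤ q → P q

RamseyEventually : 3Graph → (ℕ → ℕ → Set) → Set
RamseyEventually G B = Eventually λ q → Σ ℕ λ N → IsRamseyNumber G q N × B q N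

log₂ : ℕ → ℕ
log₂ n = ⌊log₂ n ⌋

{-# OPTIONS --safe #-}

-- Upper bounds.  For tripartite G, iterate the pigeonhole principle to find
-- K_{t,t,t}.  For G with a transversal S, fix R = r₂(t;q) vertices: every
-- further vertex sees a monochromatic K_t in its link, and many of them see
-- the same one.  For 𝒰_ℓ with ℓ ≥ 2 the colours get individual targets:
-- averaging over all transversals of R blocks gives many copies of some H,
-- in one colour i, that differ only in the image of the collapsed vertex;
-- then recurse into the set of these images with target F in place of G for
-- colour i.  The targets shrink, so this happens O(q) times.  In general,
-- use Erdős–Rado.
--
-- Lower bounds.  Two edges: give different triples different colours.  Not
-- tripartite: q random maps to three parts separate all triples of
-- 2^Ω(q) vertices.  Outside 𝒰: if c colours N points with q colours, the
-- lexicographic square of c colours N² points, and needs only two more colours,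
-- for triples with two points in a common fibre: one when the third point
-- lies in a lower fibre and one when it lies in a higher fibre.  If all
-- monochromatic 3-graphs of c are in 𝒰 then so are those of the square.
-- Starting from 3 points and 1 colour, or 4 points and 2 colours, this gives
-- 3^(2^k) points for 2k+1 colours and 2^(2^k) points for 2k colours.

module Submission where

open import Defs hiding (trans)
open import Data.Bool using (Bool; true; false; not; _∨_; if_then_else_)
open import Data.Bool.Properties using (∨-comm; ∨-assoc; not-injective) renaming (_≟_ to _≟ᵇ_)
open import Data.Empty using (⊥)
open import Data.Fin using (Fin; zero; suc; toℕ; inject≤; fromℕ<; combine; remQuot; quotient; remainder; funToFin; finToFun; join; splitAt; opposite) renaming (_<_ to _<ᶠ_)
open import Data.Fin.Properties using (_≟_; any?; all?; suc-injective; toℕ-injective; toℕ<n; toℕ-inject≤; toℕ-fromℕ<; fromℕ<-cong; fromℕ<-injective; inject≤-injective; injective⇒≤; splitAt-join; remQuot-combine; combine-remQuot; combine-injective; finToFun-funToFin; opposite-prop) renaming (<-cmp to <ᶠ-cmp; _<?_ to _<ᶠ?_; <-asym to <ᶠ-asym)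
open import Data.Fin.Subset using (Subset; _∈_; _∉_; ∣_∣; ⊤)
open import Data.Fin.Subset.Properties using (_∈?_; nonempty?; Empty-unique; ∣⊥∣≡0; ∣⊤∣≡n; ⊆⊤; ⊆-antisym; ∈⊤; p⊂q⇒∣p∣<∣q∣; ∣⁅x⁆∣≡1; x∈⁅y⁆⇒x≡y)
open import Data.Integer using (ℤ) renaming (+_ to pos; _+_ to _+ᶻ_; _*_ to _*ᶻ_; _-_ to _-ᶻ_)
open import Data.Integer.Properties using (pos-*; +-injective; i*j≡0⇒i≡0∨j≡0; i-j≡0⇒i≡j)
open import Data.Nat using (ℕ; zero; suc; _+_; _*_; _^_; _∸_; _⊔_; _≤_; _<_; z≤n; s≤s; _≤?_; _<?_)
open import Data.Nat.Logarithm using (⌊log₂⌋-mono-≤; ⌊log₂[2^n]⌋≡n)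
open import Data.Nat.Properties hiding (_≟_; suc-injective)
open import Data.Nat.Properties using () renaming (_≟_ to _≟ⁿ_)
open import Data.Nat.Tactic.RingSolver using (solve-∀)
open import Data.Product using (Σ; ∃; _×_; _,_; proj₁; proj₂)
open import Data.Sum using (_⊎_; inj₁; inj₂; [_,_]′; map)
open import Data.Sum.Properties using (inj₁-injective; inj₂-injective)
open import Data.Unit using (tt)
open import Data.Vec using (Vec; []; _∷_; lookup; tabulate; _[_]≔_)
open import Data.Vec.Functional using (updateAt) renaming (_∷_ to _∷ᶠ_)
open import Data.Vec.Functional.Properties using (updateAt-updates; updateAt-minimal)
open import Data.Vec.Properties using (lookup∘update; lookup∘update′; lookup∘tabulate; []=⇒lookup; lookup⇒[]=)
open import Algebra.Properties.Semiring.Sum +-*-semiring using (sum; sum-cong-≗; ∑-comm; *-distribˡ-sum; sum-replicate-zero)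
open import Function using (_∘_; const; mk⇔)
open import Function.Definitions using (Injective)
open import Relation.Binary.Definitions using (tri<; tri≈; tri>)
open import Relation.Binary.PropositionalEquality using (_≡_; _≢_; _≗_; refl; sym; trans; cong; cong₂; subst; subst₂; module ≡-Reasoning)
open import Relation.Nullary using (¬_; Dec; yes; no; does; contradiction)
open import Relation.Nullary.Decidable using (dec-true; dec-false; does-⇔; map′; ¬?; _×-dec_; _→-dec_; decidable-stable; from-yes)
import Data.Integer.Tactic.RingSolver as ℤ-Solver

-- Finite sums and averaging

-- Everything is constructive: a Ramsey number is a least `N`, so its existence rests on deciding
-- `Arrows`, and each probabilistic argument becomes a comparison of finite sums. The obstacle in
-- the upper bound for 𝒰 is that the copies of `H` found in colour `i` say nothing about the other
-- colours. Inside the images of the collapsed vertex, `F` in colour `i` now completes the old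
-- target, but any other colour must still produce its own. Hence the inductive statement is
-- off-diagonal. The total size of the targets is at most `q * v` and drops in every round, while a
-- round costs a factor of the order of the bound for the previous rank; so each rank adds one
-- factor `q` to the exponent. The lower bound outside 𝒰 has no slack in the exponent `q/2`:
-- squaring doubles the logarithm of the number of points for exactly two colours, so the starting
-- colourings must satisfy the bound themselves. They do, since `4 = 2^2` and `3 ≥ 2^√2`.

sum-mono-≤ : ∀ {n} {f g : Fin n → ℕ} → (∀ i → f i ≤ g i) → sum f ≤ sum g
sum-mono-≤ {zero}  h = z≤n
sum-mono-≤ {suc n} h = +-mono-≤ (h zero) (sum-mono-≤ (h ∘ suc))

sum-const : ∀ n c → sum {n} (const c) ≡ n * c
sum-const zero    c = refl
sum-const (suc n) c = cong (c +_) (sum-const n c)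

sum-average : ∀ {n} w (f : Fin (suc n) → ℕ) → suc n * w ≤ sum f → ∃ λ i → w ≤ f i
sum-average {n} w f h with any? (λ i → w ≤? f i)
... | yes p = p
... | no ¬p = contradiction h (<⇒≱ (≤-<-trans (sum-mono-≤ below)
                (subst (_< suc n * w) (sym (sum-const (suc n) (w ∸ 1))) (*-monoʳ-< (suc n) (lt w (f zero) (below′ zero))))))
  where
  below′ : ∀ i → f i < w
  below′ i = ≰⇒> (λ q → ¬p (i , q))
  below : ∀ i → f i ≤ w ∸ 1
  below i = ∸-monoˡ-≤ 1 (below′ i)
  lt : ∀ w x → x < w → w ∸ 1 < w
  lt (suc w) x _ = n<1+n w

toNat : Bool → ℕ
toNat true  = 1
toNat false = 0

count : ∀ {n} → (Fin n → Bool) → ℕ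
count p = sum (toNat ∘ p)

record Enumeration {n} (p : Fin n → Bool) (m : ℕ) : Set where
  field
    enum      : Fin m → Fin n
    injective : Injective _≡_ _≡_ enum
    sound     : ∀ j → p (enum j) ≡ true
    index     : ∀ i → p i ≡ true → ∃ λ j → enum j ≡ i

enumerate : ∀ {n} (p : Fin n → Bool) → Enumeration p (count p)
enumerate {zero}  p = record { enum = λ () ; injective = λ { {()} } ; sound = λ () ; index = λ () }
enumerate {suc n} p = extend (p zero) refl (enumerate (p ∘ suc))
  where
  extend : ∀ {m} b → p zero ≡ b → Enumeration (p ∘ suc) m → Enumeration p (toNat b + m)
  extend {m} true p0 E = record { enum = e ; injective = λ {x} {y} → inj x y ; sound = so ; index = ix }
    where
    module E = Enumeration E
    e : Fin (suc m) → Fin (suc n)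
    e zero    = zero
    e (suc j) = suc (E.enum j)
    inj : ∀ x y → e x ≡ e y → x ≡ y
    inj zero    zero    _  = refl
    inj (suc x) (suc y) eq = cong suc (E.injective (suc-injective eq))
    so : ∀ j → p (e j) ≡ true
    so zero    = p0
    so (suc j) = E.sound j
    ix : ∀ i → p i ≡ true → ∃ λ j → e j ≡ i
    ix zero    _  = zero , refl
    ix (suc i) pi = let j , eq = E.index i pi in suc j , cong suc eq
  extend false p0 E = record { enum = suc ∘ E.enum ; injective = E.injective ∘ suc-injective ; sound = E.sound ; index = ix }
    where
    module E = Enumeration E
    ix : ∀ i → p i ≡ true → ∃ λ j → suc (E.enum j) ≡ i
    ix zero    pz = contradiction (trans (sym p0) pz) λ ()
    ix (suc i) pi = let j , eq = E.index i pi in j , cong suc eq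

_==_ : ∀ {n} → Fin n → Fin n → Bool
x == y = does (x ≟ y)

does-true : ∀ {A : Set} (a? : Dec A) → does a? ≡ true → A
does-true (yes a) _ = a

==⇒≡ : ∀ {n} {x y : Fin n} → (x == y) ≡ true → x ≡ y
==⇒≡ {x = x} {y} = does-true (x ≟ y)

sum-== : ∀ {n} (x : Fin n) → sum (λ k → toNat (x == k)) ≡ 1
sum-== {suc n} zero    = cong suc (sum-replicate-zero n)
sum-== {suc n} (suc x) = trans (sum-cong-≗ {n} (λ k → cong toNat (shift k))) (sum-== x)
  where
  shift : ∀ k → (suc x == suc k) ≡ (x == k)
  shift k with x ≟ k
  ... | yes _ = refl
  ... | no  _ = refl

inject-count : ∀ {n w} (p : Fin n → Bool) → w ≤ count p →
               ∃ λ (g : Fin w → Fin n) → Injective _≡_ _≡_ g × (∀ i → p (g i) ≡ true)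
inject-count p h = (λ i → enum (inject≤ i h)) , inject≤-injective h h _ _ ∘ injective , λ i → sound (inject≤ i h)
  where open Enumeration (enumerate p)

pigeonhole : ∀ {n K} w (f : Fin n → Fin K) → 1 ≤ K → K * w ≤ n →
             ∃ λ k → ∃ λ (g : Fin w → Fin n) → Injective _≡_ _≡_ g × (∀ i → f (g i) ≡ k)
pigeonhole {n} {suc K} w f _ h =
  let k , w≤ = sum-average w (λ k → count (λ i → f i == k)) (subst (suc K * w ≤_) (sym total) h)
      g , g-inj , g-sound = inject-count (λ i → f i == k) w≤
  in k , g , g-inj , λ i → ==⇒≡ (g-sound i)
  where
  total : sum (λ k → count (λ i → f i == k)) ≡ n
  total = begin
    sum (λ k → sum (λ i → toNat (f i == k))) ≡⟨ ∑-comm (λ k i → toNat (f i == k)) ⟩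
    sum (λ i → sum (λ k → toNat (f i == k))) ≡⟨ sum-cong-≗ {n} (λ i → sum-== (f i)) ⟩
    sum {n} (const 1)                        ≡⟨ sum-const n 1 ⟩
    n * 1                                    ≡⟨ *-identityʳ n ⟩
    n                                        ∎
    where open ≡-Reasoning

-- An unnormalised expectation over a uniformly random vector; averages are then compared with
-- multiples of `n ^ R`, without division.
sumᵛ : ∀ {n} R → (Vec (Fin n) R → ℕ) → ℕ
sumᵛ zero    g = g []
sumᵛ (suc R) g = sum (λ a → sumᵛ R (g ∘ (a ∷_)))

sumᵛ-cong : ∀ {n} R {f g : Vec (Fin n) R → ℕ} → f ≗ g → sumᵛ R f ≡ sumᵛ R g
sumᵛ-cong zero    h = h []
sumᵛ-cong {n} (suc R) h = sum-cong-≗ {n} (λ a → sumᵛ-cong R (h ∘ (a ∷_)))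

sumᵛ-const : ∀ {n} R c → sumᵛ {n} R (const c) ≡ n ^ R * c
sumᵛ-const zero    c = sym (+-identityʳ c)
sumᵛ-const {n} (suc R) c = begin
  sum {n} (λ _ → sumᵛ {n} R (const c)) ≡⟨ sum-const n _ ⟩
  n * sumᵛ {n} R (const c)             ≡⟨ cong (n *_) (sumᵛ-const R c) ⟩
  n * (n ^ R * c)                      ≡⟨ sym (*-assoc n (n ^ R) c) ⟩
  n ^ suc R * c                        ∎
  where open ≡-Reasoning

sumᵛ-sum-comm : ∀ {n K} R (g : Fin K → Vec (Fin n) R → ℕ) →
                sumᵛ R (λ x → sum (λ k → g k x)) ≡ sum (λ k → sumᵛ R (g k))
sumᵛ-sum-comm zero    g = refl
sumᵛ-sum-comm {n} (suc R) g =
  trans (sum-cong-≗ {n} (λ a → sumᵛ-sum-comm R (λ k → g k ∘ (a ∷_)))) (∑-comm (λ a k → sumᵛ R (g k ∘ (a ∷_))))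

sumᵛ-average : ∀ {n} R w (f : Vec (Fin (suc n)) R → ℕ) → suc n ^ R * w ≤ sumᵛ R f → ∃ λ x → w ≤ f x
sumᵛ-average zero    w f h = [] , subst (_≤ f []) (+-identityʳ w) h
sumᵛ-average {n} (suc R) w f h =
  let a , ha = sum-average (suc n ^ R * w) (λ a → sumᵛ R (f ∘ (a ∷_))) (subst (_≤ sumᵛ (suc R) f) (*-assoc (suc n) (suc n ^ R) w) h)
      x , hx = sumᵛ-average R w (f ∘ (a ∷_)) ha
  in a ∷ x , hx

-- Resampling coordinate `j`: each vector arises from exactly `n` pairs of `x` and `a`, because the
-- old value of `x` at `j` is overwritten.
sumᵛ-lines : ∀ {n} R (j : Fin R) (g : Vec (Fin n) R → ℕ) →
             sumᵛ R (λ x → sum (λ a → g (x [ j ]≔ a))) ≡ n * sumᵛ R g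
sumᵛ-lines {n} (suc R) zero g = begin
  sum {n} (λ _ → sumᵛ R (λ x → sum (λ a → g (a ∷ x)))) ≡⟨ sum-const n _ ⟩
  n * sumᵛ R (λ x → sum (λ a → g (a ∷ x)))             ≡⟨ cong (n *_) (sumᵛ-sum-comm R (λ a x → g (a ∷ x))) ⟩
  n * sumᵛ (suc R) g                                   ∎
  where open ≡-Reasoning
sumᵛ-lines {n} (suc R) (suc j) g =
  trans (sum-cong-≗ {n} (λ a → sumᵛ-lines R j (g ∘ (a ∷_)))) (sym (*-distribˡ-sum n (λ a → sumᵛ R (g ∘ (a ∷_)))))

quotient-combine : ∀ {m n} (x : Fin m) (y : Fin n) → quotient {m} n (combine x y) ≡ x
quotient-combine x y = cong proj₁ (remQuot-combine x y)

remainder-combine : ∀ {m n} (x : Fin m) (y : Fin n) → remainder {m} n (combine x y) ≡ y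
remainder-combine {m} x y = cong proj₂ (remQuot-combine {m} x y)

cong₃ : ∀ {A B C D : Set} (f : A → B → C → D) {a a′ b b′ c c′} →
        a ≡ a′ → b ≡ b′ → c ≡ c′ → f a b c ≡ f a′ b′ c′
cong₃ f refl refl refl = refl

1≤^ : ∀ {b} m → 1 ≤ b → 1 ≤ b ^ m
1≤^ zero    _   = ≤-refl
1≤^ (suc m) 1≤b = *-mono-≤ 1≤b (1≤^ m 1≤b)

sum-average-≤ : ∀ {n} w (f : Fin (suc n) → ℕ) → sum f ≤ suc n * w → ∃ λ i → f i ≤ w
sum-average-≤ {n} w f h with any? (λ i → f i ≤? w)
... | yes p = p
... | no ¬p = contradiction h (<⇒≱ (<-≤-trans (*-monoʳ-< (suc n) (n<1+n w))
                (≤-trans (≤-reflexive (sym (sum-const (suc n) (suc w)))) (sum-mono-≤ (λ i → ≰⇒> (λ q → ¬p (i , q)))))))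

sumᵛ-average-≤ : ∀ {n} R w (f : Vec (Fin (suc n)) R → ℕ) → sumᵛ R f ≤ suc n ^ R * w → ∃ λ x → f x ≤ w
sumᵛ-average-≤ zero    w f h = [] , subst (f [] ≤_) (+-identityʳ w) h
sumᵛ-average-≤ {n} (suc R) w f h =
  let a , ha = sum-average-≤ (suc n ^ R * w) (λ a → sumᵛ R (f ∘ (a ∷_))) (subst (sumᵛ (suc R) f ≤_) (*-assoc (suc n) (suc n ^ R) w) h)
      x , hx = sumᵛ-average-≤ R w (f ∘ (a ∷_)) ha
  in a ∷ x , hx

*-distribˡ-sumᵛ : ∀ {n} R c (f : Vec (Fin n) R → ℕ) → c * sumᵛ R f ≡ sumᵛ R (λ x → c * f x)
*-distribˡ-sumᵛ zero    c f = refl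
*-distribˡ-sumᵛ {n} (suc R) c f =
  trans (*-distribˡ-sum c (λ a → sumᵛ R (f ∘ (a ∷_)))) (sum-cong-≗ {n} (λ a → *-distribˡ-sumᵛ R c (f ∘ (a ∷_))))

-- Existence of Ramsey numbers

edge-≢₁₂ : ∀ G {x y z} → Edge G x y z → x ≢ y
edge-≢₁₂ G {x} {.x} {z} e refl = contradiction (trans (sym e) (loopless G x z)) λ ()

edge-≢₂₃ : ∀ G {x y z} → Edge G x y z → y ≢ z
edge-≢₂₃ G {x} {y} {z} e = edge-≢₁₂ G (trans (sym (trans (sym₁₂ G x y z) (sym₂₃ G y x z))) e)

edge-≢₁₃ : ∀ G {x y z} → Edge G x y z → x ≢ z
edge-≢₁₃ G {x} {y} {z} e = edge-≢₁₂ G (trans (sym (sym₂₃ G x y z)) e)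

pull : ∀ {m n q} → (Fin m → Fin n) → Colouring n q → Colouring m q
pull f c = record
  { col    = λ x y z → col c (f x) (f y) (f z)
  ; csym₁₂ = λ x y z → csym₁₂ c (f x) (f y) (f z)
  ; csym₂₃ = λ x y z → csym₂₃ c (f x) (f y) (f z) }

push-copy : ∀ G {m n q} (f : Fin m → Fin n) → Injective _≡_ _≡_ f → (c : Colouring n q) {i : Fin q} →
            MonoCopy G (pull f c) i → MonoCopy G c i
push-copy G f f-inj c (φ , φ-inj , mono) = f ∘ φ , φ-inj ∘ f-inj , mono

injective? : ∀ {m n} (f : Fin m → Fin n) → Dec (Injective _≡_ _≡_ f)
injective? f = map′ (λ h {x} {y} → h x y) (λ h x y → h {x} {y})
  (all? λ x → all? λ y → (f x ≟ f y) →-dec (x ≟ y))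

-- `MonoCopy` for a bare function, because the tables enumerated in `arrows?` need not be symmetric.
MonoMap : (G : 3Graph) {N q : ℕ} → (Fin N → Fin N → Fin N → Fin q) → Fin q → Set
MonoMap G χ i = Σ (Fin (V G) → Fin _) λ φ → Injective _≡_ _≡_ φ ×
  (∀ x y z → Edge G x y z → χ (φ x) (φ y) (φ z) ≡ i)

monoMap? : ∀ G {N q} (χ : Fin N → Fin N → Fin N → Fin q) i → Dec (MonoMap G χ i)
monoMap? G {N} χ i = map′ (λ (k , h) → dec k , h) encode
  (any? λ k → injective? (dec k) ×-dec
    (all? λ x → all? λ y → all? λ z → (E G x y z ≟ᵇ true) →-dec (χ (dec k x) (dec k y) (dec k z) ≟ i)))
  where
  dec : Fin (N ^ V G) → Fin (V G) → Fin N
  dec = finToFun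
  encode : MonoMap G χ i → ∃ λ k → Injective _≡_ _≡_ (dec k) ×
    (∀ x y z → Edge G x y z → χ (dec k x) (dec k y) (dec k z) ≡ i)
  encode (φ , φ-inj , mono) = funToFin φ ,
    (λ {x} {y} h → φ-inj (trans (sym (back x)) (trans h (back y)))) ,
    λ x y z e → trans (cong₃ χ (back x) (back y) (back z)) (mono x y z e)
    where
    back : finToFun (funToFin φ) ≗ φ
    back = finToFun-funToFin φ

-- A colouring is a table with `N * (N * N)` entries, hence a number below `q ^ Cube`, and a finite
-- search over these numbers decides the property. Tables that are not symmetric are passed over.
arrows? : ∀ G q N → Dec (Arrows G q N)
arrows? G q N = map′ decode (λ h k (s , t) → h (record { col = at k ; csym₁₂ = s ; csym₂₃ = t }))
    (all? λ k → symmetric? k →-dec any? (monoMap? G (at k)))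
  where
  Cube = N * (N * N)
  at : Fin (q ^ Cube) → Fin N → Fin N → Fin N → Fin q
  at k x y z = finToFun k (combine x (combine y z))
  Symmetric : Fin (q ^ Cube) → Set
  Symmetric k = (∀ x y z → at k x y z ≡ at k y x z) × (∀ x y z → at k x y z ≡ at k x z y)
  symmetric? : ∀ k → Dec (Symmetric k)
  symmetric? k = (all? λ x → all? λ y → all? λ z → at k x y z ≟ at k y x z) ×-dec
                 (all? λ x → all? λ y → all? λ z → at k x y z ≟ at k x z y)
  decode : (∀ k → Symmetric k → ∃ (MonoMap G (at k))) → Arrows G q N
  decode h c =
    let i , φ , φ-inj , mono = h (funToFin entry) (s , t)
    in i , φ , φ-inj , λ x y z e → trans (sym (at-entry _ _ _)) (mono x y z e)
    where
    entry : Fin Cube → Fin q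
    entry j = let yz = remainder {N} (N * N) j in col c (quotient (N * N) j) (quotient N yz) (remainder {N} N yz)
    at-entry : ∀ x y z → at (funToFin entry) x y z ≡ col c x y z
    at-entry x y z = trans (finToFun-funToFin entry (combine x (combine y z)))
      (cong₃ (col c) (quotient-combine x (combine y z))
        (trans (cong (quotient N) (remainder-combine x (combine y z))) (quotient-combine y z))
        (trans (cong (remainder {N} N) (remainder-combine x (combine y z))) (remainder-combine y z)))
    s : ∀ x y z → at (funToFin entry) x y z ≡ at (funToFin entry) y x z
    s x y z = trans (at-entry x y z) (trans (csym₁₂ c x y z) (sym (at-entry y x z)))
    t : ∀ x y z → at (funToFin entry) x y z ≡ at (funToFin entry) x z y
    t x y z = trans (at-entry x y z) (trans (csym₂₃ c x y z) (sym (at-entry x z y)))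

least : ∀ {P : ℕ → Set} → (∀ n → Dec (P n)) → ∀ n → P n →
        ∃ λ m → m ≤ n × P m × (∀ k → k < m → ¬ P k)
least P? zero p = zero , z≤n , p , λ k ()
least P? (suc n) p with P? zero
... | yes p0 = zero , z≤n , p0 , λ k ()
... | no ¬p0 =
  let m , m≤n , pm , below = least (P? ∘ suc) n p
  in suc m , s≤s m≤n , pm , λ { zero _ → ¬p0 ; (suc k) (s≤s k<m) → below k k<m }

ramsey-number-below : ∀ G {q} N → 1 ≤ N → Arrows G q N → ∃ λ M → IsRamseyNumber G q M × M ≤ N
ramsey-number-below G {q} (suc N) _ arr =
  let m , m≤N , arr′ , below = least (arrows? G q ∘ suc) N arr
  in suc m , (s≤s z≤n , arr′ , λ { (suc k) _ (s≤s k<m) → below k k<m }) , s≤s m≤N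

inject-arrows : ∀ G {q N M} → N ≤ M → Arrows G q N → Arrows G q M
inject-arrows G N≤M arr c =
  let i , copy = arr (pull (λ x → inject≤ x N≤M) c)
  in i , push-copy G _ (inject≤-injective N≤M N≤M _ _) c copy

-- Homogeneous sequences

wlog-sorted : ∀ {n} (P : Fin n → Fin n → Fin n → Set) →
  (∀ x y z → P x y z → P y x z) → (∀ x y z → P x y z → P x z y) →
  (∀ x y z → x <ᶠ y → y <ᶠ z → P x y z) →
  ∀ x y z → x ≢ y → y ≢ z → x ≢ z → P x y z
wlog-sorted P s t h x y z x≢y y≢z x≢z with <ᶠ-cmp x y | <ᶠ-cmp y z | <ᶠ-cmp x z
... | tri≈ _ e _ | _ | _ = contradiction e x≢y
... | _ | tri≈ _ e _ | _ = contradiction e y≢z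
... | _ | _ | tri≈ _ e _ = contradiction e x≢z
... | tri< a _ _ | tri< b _ _ | _ = h x y z a b
... | tri< a _ _ | tri> _ _ b | tri< c _ _ = t _ _ _ (h x z y c b)
... | tri< a _ _ | tri> _ _ b | tri> _ _ c = t _ _ _ (s _ _ _ (h z x y c a))
... | tri> _ _ a | tri< b _ _ | tri< c _ _ = s _ _ _ (h y x z a c)
... | tri> _ _ a | tri< b _ _ | tri> _ _ c = s _ _ _ (t _ _ _ (h y z x b c))
... | tri> _ _ a | tri> _ _ b | _ = s _ _ _ (t _ _ _ (s _ _ _ (h z y x b a)))

-- One vertex is kept, the pigeonhole on the colours of its pairs costs a factor `Q`, and merging
-- its link into the pair colouring leaves `Q * q` pair colours for the rest.
need : ℕ → ℕ → ℕ → ℕ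
need q zero    Q = 0
need q (suc M) Q = suc (Q * need q M (Q * q))

-- Each new entry h 0 turns χ (h 0) into one more pair colouring to be
-- taken care of, which is why ρ is carried along.
homogeneous : ∀ {q} M {Q n} (ρ : Fin n → Fin n → Fin (suc Q)) (χ : Fin n → Fin n → Fin n → Fin (suc q)) →
  need (suc q) M (suc Q) ≤ n →
  ∃ λ (h : Fin M → Fin n) → Injective _≡_ _≡_ h ×
  (∃ λ (k : Fin M → Fin (suc Q)) → ∀ i j → i <ᶠ j → ρ (h i) (h j) ≡ k i) ×
  (∃ λ (l : Fin M → Fin M → Fin (suc q)) → ∀ i j m → i <ᶠ j → j <ᶠ m → χ (h i) (h j) (h m) ≡ l i j)
homogeneous zero ρ χ _ = (λ ()) , (λ { {()} }) , ((λ ()) , λ ()) , ((λ ()) , λ ())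
homogeneous {q} (suc M) {Q} {suc n} ρ χ (s≤s le)
  with k₀ , g , g-inj , g-col ← pigeonhole (need (suc q) M (suc Q * suc q)) (λ a → ρ zero (suc a)) (s≤s z≤n) le
  with h′ , h′-inj , (k′ , k′-ok) , (l′ , l′-ok) ←
    homogeneous M (λ a b → combine (ρ (suc (g a)) (suc (g b))) (χ zero (suc (g a)) (suc (g b))))
      (λ a b c → χ (suc (g a)) (suc (g b)) (suc (g c))) ≤-refl
  = h , (λ {x} {y} → h-inj x y) , (k , k-ok) , (l , l-ok)
  where
  h : Fin (suc M) → Fin (suc n)
  h zero    = zero
  h (suc i) = suc (g (h′ i))
  h-inj : ∀ x y → h x ≡ h y → x ≡ y
  h-inj zero    zero    _  = refl
  h-inj (suc x) (suc y) eq = cong suc (h′-inj (g-inj (suc-injective eq)))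
  k : Fin (suc M) → Fin (suc Q)
  k zero    = k₀
  k (suc i) = quotient (suc q) (k′ i)
  k-ok : ∀ i j → i <ᶠ j → ρ (h i) (h j) ≡ k i
  k-ok zero    (suc j) _         = g-col (h′ j)
  k-ok (suc i) (suc j) (s≤s i<j) = trans (sym (quotient-combine (ρ (h (suc i)) (h (suc j))) (χ zero (h (suc i)) (h (suc j))))) (cong (quotient (suc q)) (k′-ok i j i<j))
  l : Fin (suc M) → Fin (suc M) → Fin (suc q)
  l (suc i) (suc j) = l′ i j
  l zero    (suc j) = remainder {suc Q} (suc q) (k′ j)
  -- Never consulted, since no index lies before `zero`.
  l _       zero    = zero
  l-ok : ∀ i j m → i <ᶠ j → j <ᶠ m → χ (h i) (h j) (h m) ≡ l i j
  l-ok zero    (suc j) (suc m) _         (s≤s j<m) =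
    trans (sym (remainder-combine (ρ (h (suc j)) (h (suc m))) _)) (cong (remainder {suc Q} (suc q)) (k′-ok j m j<m))
  l-ok (suc i) (suc j) (suc m) (s≤s i<j) (s≤s j<m) = l′-ok i j m i<j j<m

-- At every stage there are at most `Q * q ^ M` pair colours, and the factor 2 absorbs the vertex
-- that is kept.
need-bound : ∀ {q} M {Q} → 1 ≤ q → 1 ≤ Q → need q M Q ≤ (Q * q ^ M * 2) ^ M
need-bound zero _ _ = z≤n
need-bound {q} (suc M) {Q} 1≤q 1≤Q = begin
  1 + Q * need q M (Q * q)             ≤⟨ +-monoʳ-≤ 1 (*-monoʳ-≤ Q (need-bound M 1≤q (*-mono-≤ 1≤Q 1≤q))) ⟩
  1 + Q * (Q * q * q ^ M * 2) ^ M      ≡⟨ cong (λ b → 1 + Q * (b * 2) ^ M) (*-assoc Q q (q ^ M)) ⟩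
  1 + Q * B ^ M                        ≤⟨ +-monoˡ-≤ (Q * B ^ M) (*-mono-≤ 1≤Q (1≤^ M 1≤B)) ⟩
  Q * B ^ M + Q * B ^ M                ≡⟨ cong (Q * B ^ M +_) (sym (+-identityʳ _)) ⟩
  2 * (Q * B ^ M)                      ≡⟨ sym (*-assoc 2 Q (B ^ M)) ⟩
  2 * Q * B ^ M                        ≤⟨ *-monoˡ-≤ (B ^ M) 2Q≤B ⟩
  B ^ suc M                            ∎
  where
  open ≤-Reasoning
  B = Q * q ^ suc M * 2
  1≤B : 1 ≤ B
  1≤B = *-mono-≤ (*-mono-≤ 1≤Q (1≤^ (suc M) 1≤q)) (s≤s {n = 1} z≤n)
  2Q≤B : 2 * Q ≤ B
  2Q≤B = begin
    2 * Q              ≡⟨ *-comm 2 Q ⟩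
    Q * 2              ≡⟨ cong (_* 2) (sym (*-identityʳ Q)) ⟩
    Q * 1 * 2          ≤⟨ *-monoˡ-≤ 2 (*-monoʳ-≤ Q (1≤^ (suc M) 1≤q)) ⟩
    B                  ∎

-- In a homogeneous sequence the colour of a pair is a function of its earlier member, so `t`
-- members with the same value form a clique. The triple colouring passed along has a single colour
-- and adds no cost.
clique₂ : ∀ t {q n} (ρ : Fin n → Fin n → Fin (suc q)) → (∀ i j → ρ i j ≡ ρ j i) →
  (suc q * 2) ^ (suc q * t) ≤ n →
  ∃ λ c → ∃ λ (g : Fin t → Fin n) → Injective _≡_ _≡_ g × (∀ i j → i ≢ j → ρ (g i) (g j) ≡ c)
clique₂ t {q} ρ ρ-sym le
  with h , h-inj , (k , k-ok) , _ ← homogeneous (suc q * t) ρ (λ _ _ _ → zero {0})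
         (≤-trans (need-bound (suc q * t) (s≤s z≤n) (s≤s z≤n)) (≤-trans (≤-reflexive (cong (λ o → (o * 2) ^ (suc q * t)) (trans (cong (suc q *_) (^-zeroˡ (suc q * t))) (*-identityʳ (suc q))))) le))
  with c , g , g-inj , g-col ← pigeonhole t k (s≤s z≤n) ≤-refl
  = c , h ∘ g , g-inj ∘ h-inj , λ i j i≢j → ok i j (i≢j ∘ g-inj)
  where
  ok : ∀ i j → g i ≢ g j → ρ (h (g i)) (h (g j)) ≡ c
  ok i j ne with <ᶠ-cmp (g i) (g j)
  ... | tri< lt _ _ = trans (k-ok _ _ lt) (g-col i)
  ... | tri≈ _ eq _ = contradiction eq ne
  ... | tri> _ _ gt = trans (ρ-sym _ _) (trans (k-ok _ _ gt) (g-col j))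

-- Along a homogeneous sequence the colour of an increasing triple depends only on its first two
-- members, and `clique₂` for this pair colouring finishes. The length `M` that `clique₂` asks for
-- becomes an exponent, hence the double exponential.
clique₃ : ∀ t {q n} (c : Colouring n (suc q)) →
  (let M = (suc q * 2) ^ (suc q * t)) → (suc q ^ M * 2) ^ M ≤ n →
  ∃ λ k → ∃ λ (g : Fin t → Fin n) → Injective _≡_ _≡_ g ×
    (∀ x y z → x ≢ y → y ≢ z → x ≢ z → col c (g x) (g y) (g z) ≡ k)
clique₃ t {q} c le
  with h , h-inj , _ , (l , l-ok) ← homogeneous ((suc q * 2) ^ (suc q * t)) (λ _ _ → zero {0}) (col c)
         (≤-trans (need-bound ((suc q * 2) ^ (suc q * t)) (s≤s z≤n) (s≤s z≤n))
           (≤-trans (≤-reflexive (cong (λ o → (o * 2) ^ ((suc q * 2) ^ (suc q * t))) (*-identityˡ (suc q ^ ((suc q * 2) ^ (suc q * t)))))) le))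
  = k , h ∘ g , g-inj ∘ h-inj , λ x y z x≢y y≢z x≢z →
      wlog-sorted P s t′ sorted (g x) (g y) (g z) (x≢y ∘ g-inj) (y≢z ∘ g-inj) (x≢z ∘ g-inj)
        (g-col x y x≢y) (g-col y z y≢z) (g-col x z x≢z)
  where
  M = (suc q * 2) ^ (suc q * t)
  ρ : Fin M → Fin M → Fin (suc q)
  ρ i j with i <ᶠ? j
  ... | yes _ = l i j
  ... | no  _ = l j i
  ρ-< : ∀ {i j} → i <ᶠ j → ρ i j ≡ l i j
  ρ-< {i} {j} lt with i <ᶠ? j
  ... | yes _  = refl
  ... | no ¬lt = contradiction lt ¬lt
  ρ-> : ∀ {i j} → i <ᶠ j → ρ j i ≡ l i j
  ρ-> {i} {j} lt with j <ᶠ? i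
  ... | yes gt = contradiction gt (<ᶠ-asym lt)
  ... | no _   = refl
  ρ-sym : ∀ i j → ρ i j ≡ ρ j i
  ρ-sym i j with <ᶠ-cmp i j
  ... | tri< lt _ _   = trans (ρ-< lt) (sym (ρ-> lt))
  ... | tri≈ _ refl _ = refl
  ... | tri> _ _ gt   = trans (ρ-> gt) (sym (ρ-< gt))
  clq = clique₂ t ρ ρ-sym ≤-refl
  k = proj₁ clq
  g = proj₁ (proj₂ clq)
  g-inj : Injective _≡_ _≡_ g
  g-inj = proj₁ (proj₂ (proj₂ clq))
  g-col = proj₂ (proj₂ (proj₂ clq))
  -- Keeping the pair colours as hypotheses makes `P` invariant under permutations of its arguments,
  -- as `wlog-sorted` requires.
  P : Fin M → Fin M → Fin M → Set
  P x y z = ρ x y ≡ k → ρ y z ≡ k → ρ x z ≡ k → col c (h x) (h y) (h z) ≡ k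
  s : ∀ x y z → P x y z → P y x z
  s x y z p yx xz yz = trans (csym₁₂ c _ _ _) (p (trans (ρ-sym x y) yx) yz xz)
  t′ : ∀ x y z → P x y z → P x z y
  t′ x y z p xz zy xy = trans (csym₂₃ c _ _ _) (p xy (trans (ρ-sym y z) zy) xz)
  sorted : ∀ x y z → x <ᶠ y → y <ᶠ z → P x y z
  sorted x y z lt lt′ xy _ _ = trans (l-ok x y z lt lt′) (trans (sym (ρ-< lt)) xy)

-- Tripartite 3-graphs

join-injective : ∀ {m n} {s t : Fin m ⊎ Fin n} → join m n s ≡ join m n t → s ≡ t
join-injective {m} {n} {s} {t} eq = trans (sym (splitAt-join m n s)) (trans (cong (splitAt m) eq) (splitAt-join m n t))

place : ∀ m n {N} → m + n ≤ N → Fin m ⊎ Fin n → Fin N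
place m n le s = inject≤ (join m n s) le

place-injective : ∀ m n {N} (le : m + n ≤ N) s t → place m n le s ≡ place m n le t → s ≡ t
place-injective m n le s t eq = join-injective {m} {n} {s} {t} (inject≤-injective le le _ _ eq)

-- A colour and a `t`-tuple of points packed into one number can serve as a colour in the next
-- pigeonhole.
module Code (q t n : ℕ) where

  code : Fin q → (Fin t → Fin n) → Fin (q * n ^ t)
  code k g = combine k (funToFin g)

  colour : Fin (q * n ^ t) → Fin q
  colour = quotient (n ^ t)

  support : Fin (q * n ^ t) → Fin t → Fin n
  support l = finToFun (remainder {q} (n ^ t) l)

  colour-code : ∀ k g → colour (code k g) ≡ k
  colour-code k g = quotient-combine k (funToFin g)

  support-code : ∀ k g → support (code k g) ≗ g
  support-code k g i = trans (cong (λ r → finToFun {n} r i) (remainder-combine k (funToFin g))) (finToFun-funToFin g i)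

  support-code-injective : ∀ k {g} → Injective _≡_ _≡_ g → Injective _≡_ _≡_ (support (code k g))
  support-code-injective k {g} g-inj {x} {y} eq =
    g-inj (trans (sym (support-code k g x)) (trans eq (support-code k g y)))

labels : ℕ → ℕ → ℕ
labels t q = q * (q * t) ^ t

1≤labels : ∀ t {q} → 1 ≤ t → 1 ≤ q → 1 ≤ labels t q
1≤labels t 1≤t 1≤q = *-mono-≤ 1≤q (1≤^ t (*-mono-≤ 1≤q 1≤t))

Popular : ∀ q t → (Fin (q * t) → Fin q) → Fin (labels t q) → Set
Popular q t f l = Injective _≡_ _≡_ (support l) × (∀ i → f (support l i) ≡ colour l)
  where open Code q t (q * t)

popular : ∀ {q} t → 1 ≤ q → (f : Fin (q * t) → Fin q) → ∃ (Popular q t f)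
popular {q} t 1≤q f with k , g , g-inj , g-col ← pigeonhole t f 1≤q ≤-refl =
  code k g , support-code-injective k g-inj ,
  λ i → trans (cong f (support-code k g i)) (trans (g-col i) (sym (colour-code k g)))
  where open Code q t (q * t)

tripartite-size : ℕ → ℕ → ℕ
tripartite-size t q = let Q = labels t q in q * t + (Q * t + labels t Q * t)

-- Three nested pigeonholes. Each pair from the second and third block sees `t` points of the first
-- in one colour, and this label colours the pair. Each point of the third block then sees one label
-- on `t` points of the second, and this larger label colours the third block. For fixed `t` the
-- labels are polynomially many in `q`.
tripartite-clique : ∀ t {q N} → 1 ≤ t → 1 ≤ q → (c : Colouring N q) → tripartite-size t q ≤ N →
  ∃ λ k → ∃ λ (g : Fin 3 → Fin t → Fin N) →
    (∀ a b x y → g a x ≡ g b y → x ≡ y) ×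
    (∀ x y z → col c (g zero x) (g (suc zero) y) (g (suc (suc zero)) z) ≡ k)
tripartite-clique t {q} {N} 1≤t 1≤q c le = k , g , g-inj , mono
  where
  Q = labels t q
  1≤Q = 1≤labels t 1≤t 1≤q
  module C₁ = Code q t (q * t)
  module C₂ = Code Q t (Q * t)
  spots = place (q * t) (Q * t + labels t Q * t) le
  spots-inj = place-injective (q * t) (Q * t + labels t Q * t) le
  A : Fin (q * t) → Fin N
  A a = spots (inj₁ a)
  BC : Fin (Q * t) ⊎ Fin (labels t Q * t) → Fin N
  BC s = spots (inj₂ (join (Q * t) (labels t Q * t) s))
  BC-inj : ∀ s s′ → BC s ≡ BC s′ → s ≡ s′
  BC-inj s s′ eq = join-injective {Q * t} {labels t Q * t} {s} {s′} (inj₂-injective (spots-inj (inj₂ _) (inj₂ _) eq))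
  f₁ : Fin (Q * t) → Fin (labels t Q * t) → Fin (q * t) → Fin q
  f₁ b c′ a = col c (A a) (BC (inj₁ b)) (BC (inj₂ c′))
  pop₁ : ∀ b c′ → ∃ (Popular q t (f₁ b c′))
  pop₁ b c′ = popular t 1≤q (f₁ b c′)
  f₂ : Fin (labels t Q * t) → Fin (Q * t) → Fin Q
  f₂ c′ b = proj₁ (pop₁ b c′)
  pop₂ : ∀ c′ → ∃ (Popular Q t (f₂ c′))
  pop₂ c′ = popular t 1≤Q (f₂ c′)
  hole = pigeonhole t (λ c′ → proj₁ (pop₂ c′)) (1≤labels t 1≤t 1≤Q) ≤-refl
  l₂ = proj₁ hole
  gC = proj₁ (proj₂ hole)
  l₁ = C₂.colour l₂
  k = C₁.colour l₁
  Q₂ : ∀ z → Popular Q t (f₂ (gC z)) l₂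
  Q₂ z = subst (Popular Q t (f₂ (gC z))) (proj₂ (proj₂ (proj₂ hole)) z) (proj₂ (pop₂ (gC z)))
  Q₁ : ∀ y z → Popular q t (f₁ (C₂.support l₂ y) (gC z)) l₁
  Q₁ y z = subst (Popular q t (f₁ (C₂.support l₂ y) (gC z))) (proj₂ (Q₂ z) y) (proj₂ (pop₁ (C₂.support l₂ y) (gC z)))
  g : Fin 3 → Fin t → Fin N
  g zero             x = A (C₁.support l₁ x)
  g (suc zero)       y = BC (inj₁ (C₂.support l₂ y))
  g (suc (suc zero)) z = BC (inj₂ (gC z))
  mono : ∀ x y z → col c (g zero x) (g (suc zero) y) (g (suc (suc zero)) z) ≡ k
  mono x y z = proj₂ (Q₁ y z) x
  g-inj : ∀ a b x y → g a x ≡ g b y → x ≡ y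
  g-inj zero zero x y eq = proj₁ (Q₁ x x) (inj₁-injective (spots-inj (inj₁ _) (inj₁ _) eq))
  g-inj zero (suc zero) x y eq = contradiction (spots-inj (inj₁ _) (inj₂ _) eq) λ ()
  g-inj zero (suc (suc zero)) x y eq = contradiction (spots-inj (inj₁ _) (inj₂ _) eq) λ ()
  g-inj (suc zero) zero x y eq = contradiction (spots-inj (inj₂ _) (inj₁ _) eq) λ ()
  g-inj (suc zero) (suc zero) x y eq = proj₁ (Q₂ x) (inj₁-injective (BC-inj (inj₁ _) (inj₁ _) eq))
  g-inj (suc zero) (suc (suc zero)) x y eq = contradiction (BC-inj (inj₁ _) (inj₂ _) eq) λ ()
  g-inj (suc (suc zero)) zero x y eq = contradiction (spots-inj (inj₂ _) (inj₁ _) eq) λ ()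
  g-inj (suc (suc zero)) (suc zero) x y eq = contradiction (BC-inj (inj₂ _) (inj₁ _) eq) λ ()
  g-inj (suc (suc zero)) (suc (suc zero)) x y eq = proj₁ (proj₂ (proj₂ hole)) (inj₂-injective (BC-inj (inj₂ _) (inj₂ _) eq))

-- Vertex `x` takes the point numbered `x` in its part, so the conclusion `x ≡ y` of
-- `tripartite-clique` is exactly the injectivity required.
tripartite-arrows : ∀ G {q N} → Tripartite G → 1 ≤ V G → 1 ≤ q → tripartite-size (V G) q ≤ N → Arrows G q N
tripartite-arrows G (part , rainbow) 1≤V 1≤q le c
  with k , g , g-inj , mono ← tripartite-clique (V G) 1≤V 1≤q c le =
  k , (λ x → g (part x) x) , (λ {x} {y} → g-inj (part x) (part y) x y) ,
  λ x y z e → let x≢y , y≢z , x≢z = rainbow x y z e in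
    wlog-sorted (λ a b d → ∀ x y z → col c (g a x) (g b y) (g d z) ≡ k)
      (λ _ _ _ h x y z → trans (csym₁₂ c _ _ _) (h y x z))
      (λ _ _ _ h x y z → trans (csym₂₃ c _ _ _) (h x z y))
      sorted (part x) (part y) (part z) x≢y y≢z x≢z x y z
  where
  sorted : ∀ a b d → a <ᶠ b → b <ᶠ d → ∀ x y z → col c (g a x) (g b y) (g d z) ≡ k
  sorted zero (suc zero) (suc (suc zero)) _ _ = mono
  sorted _ (suc zero) (suc zero) _ (s≤s ())
  sorted _ (suc (suc zero)) (suc zero) _ (s≤s ())
  sorted _ (suc (suc zero)) (suc (suc zero)) _ (s≤s (s≤s ()))
  sorted (suc zero) (suc zero) _ (s≤s ()) _
  sorted (suc (suc zero)) (suc zero) _ (s≤s ()) _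

-- One-vertex transversals

star-size : ℕ → ℕ → ℕ
star-size t q = let R = (q * 2) ^ (q * t) in q * R ^ t * t + R

star-clique : ∀ t {q N} → 1 ≤ q → (c : Colouring N q) → star-size t q ≤ N →
  ∃ λ k → ∃ λ (g : Bool → Fin t → Fin N) →
    (∀ a b x y → g a x ≡ g b y → x ≡ y) ×
    (∀ x y z → y ≢ z → col c (g true x) (g false y) (g false z) ≡ k)
star-clique t {suc q} {N} 1≤q c le = k , g , g-inj , mono
  where
  R = (suc q * 2) ^ (suc q * t)
  open Code (suc q) t R
  spots = place (suc q * R ^ t * t) R le
  spots-inj = place-injective (suc q * R ^ t * t) R le
  A : Fin (suc q * R ^ t * t) → Fin N
  A a = spots (inj₁ a)
  B : Fin R → Fin N
  B b = spots (inj₂ b)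
  Good : Fin (suc q * R ^ t * t) → Fin (suc q * R ^ t) → Set
  Good a l = Injective _≡_ _≡_ (support l) × (∀ y z → y ≢ z → col c (A a) (B (support l y)) (B (support l z)) ≡ colour l)
  good : ∀ a → ∃ (Good a)
  good a =
    let k , g , g-inj , g-col = clique₂ t (λ y z → col c (A a) (B y) (B z)) (λ y z → csym₂₃ c _ _ _) ≤-refl
    in code k g , support-code-injective k g-inj , λ y z y≢z →
      trans (cong₂ (λ b b′ → col c (A a) (B b) (B b′)) (support-code k g y) (support-code k g z))
        (trans (g-col y z y≢z) (sym (colour-code k g)))
  hole = pigeonhole t (λ a → proj₁ (good a)) (*-mono-≤ 1≤q (1≤^ t (1≤^ {suc q * 2} (suc q * t) (s≤s z≤n)))) ≤-refl
  l = proj₁ hole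
  gA = proj₁ (proj₂ hole)
  k = colour l
  good-l : ∀ x → Good (gA x) l
  good-l x = subst (Good (gA x)) (proj₂ (proj₂ (proj₂ hole)) x) (proj₂ (good (gA x)))
  g : Bool → Fin t → Fin N
  g true  x = A (gA x)
  g false y = B (support l y)
  mono : ∀ x y z → y ≢ z → col c (g true x) (g false y) (g false z) ≡ k
  mono x = proj₂ (good-l x)
  g-inj : ∀ a b x y → g a x ≡ g b y → x ≡ y
  g-inj true  true  x y eq = proj₁ (proj₂ (proj₂ hole)) (inj₁-injective (spots-inj (inj₁ _) (inj₁ _) eq))
  g-inj true  false x y eq = contradiction (spots-inj (inj₁ _) (inj₂ _) eq) λ ()
  g-inj false true  x y eq = contradiction (spots-inj (inj₂ _) (inj₁ _) eq) λ ()
  g-inj false false x y eq = proj₁ (good-l x) (inj₂-injective (spots-inj (inj₂ _) (inj₂ _) eq))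

-- The colour comes before the 3-graph: the star found contains all candidates at once, so the
-- target may be chosen according to the colour.
transversal-arrows : ∀ {v q N} → 1 ≤ q → (c : Colouring N q) → star-size v q ≤ N →
  ∃ λ k → ∀ G → V G ≤ v → OneTransversal G → MonoCopy G c k
transversal-arrows {v} 1≤q c le with k , g , g-inj , mono ← star-clique v 1≤q c le =
  k , λ G V≤v (S , one) →
    let ix : Fin (V G) → Fin v
        ix x = inject≤ x V≤v
        ix-inj : ∀ {x y} → ix x ≡ ix y → x ≡ y
        ix-inj = inject≤-injective V≤v V≤v _ _
    in (λ x → g (lookup S x) (ix x)) ,
       (λ {x} {y} eq → ix-inj (g-inj (lookup S x) (lookup S y) (ix x) (ix y) eq)) ,
       λ x y z e → case S (ix x) (ix y) (ix z) x y z (one x y z e)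
         (edge-≢₁₂ G e ∘ ix-inj) (edge-≢₂₃ G e ∘ ix-inj) (edge-≢₁₃ G e ∘ ix-inj)
  where
  case : ∀ {n} (S : Subset n) (i j m : Fin v) x y z → meet S x y z ≡ 1 → i ≢ j → j ≢ m → i ≢ m →
         col c (g (lookup S x) i) (g (lookup S y) j) (g (lookup S z) m) ≡ k
  case S i j m x y z one i≢j j≢m i≢m with lookup S x | lookup S y | lookup S z
  ... | true  | false | false = mono i j m j≢m
  ... | false | true  | false = trans (csym₁₂ c _ _ _) (mono j i m i≢m)
  ... | false | false | true  = trans (csym₂₃ c _ _ _) (trans (csym₁₂ c _ _ _) (mono m i j i≢j))

-- Reducible 3-graphs

-- Some label sits on at least a `1/K` share of all vectors. Partition the vectors into lines in the
-- direction `d k` of that label; an average line has at least `n/K` vectors with it. The label must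
-- be fixed first because it determines the direction.
popular-line : ∀ {n R K} w (f : Vec (Fin n) R → Fin K) (d : Fin K → Fin R) → 1 ≤ n → 1 ≤ K → K * w ≤ n →
  ∃ λ k → ∃ λ x → ∃ λ (g : Fin w → Fin n) → Injective _≡_ _≡_ g × (∀ a → f (x [ d k ]≔ g a) ≡ k)
popular-line {suc n} {R} {suc K} w f d _ _ le =
  let k , often    = sum-average (suc n ^ R) (λ k → suc K * size k) (≤-reflexive (sym total))
      x , w≤       = sumᵛ-average R w (λ x → count (λ a → f (x [ d k ]≔ a) == k))
                       (≤-trans (dense k often) (≤-reflexive (sym (sumᵛ-lines R (d k) (λ x → toNat (f x == k))))))
      g , g-inj , h = inject-count (λ a → f (x [ d k ]≔ a) == k) w≤
  in k , x , g , g-inj , λ a → ==⇒≡ (h a)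
  where
  size : Fin (suc K) → ℕ
  size k = sumᵛ R (λ x → toNat (f x == k))
  total : sum (λ k → suc K * size k) ≡ suc K * suc n ^ R
  total = begin
    sum (λ k → suc K * size k)                                 ≡⟨ sym (*-distribˡ-sum (suc K) size) ⟩
    suc K * sum size                                           ≡⟨ cong (suc K *_) (sym (sumᵛ-sum-comm R (λ k x → toNat (f x == k)))) ⟩
    suc K * sumᵛ R (λ x → sum (λ k → toNat (f x == k)))        ≡⟨ cong (suc K *_) (sumᵛ-cong R (λ x → sum-== (f x))) ⟩
    suc K * sumᵛ {suc n} R (const 1)                           ≡⟨ cong (suc K *_) (sumᵛ-const R 1) ⟩
    suc K * (suc n ^ R * 1)                                    ≡⟨ cong (suc K *_) (*-identityʳ _) ⟩
    suc K * suc n ^ R                                          ∎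
    where open ≡-Reasoning
  dense : ∀ k → suc n ^ R ≤ suc K * size k → suc n ^ R * w ≤ suc n * size k
  dense k often = begin
    suc n ^ R * w        ≤⟨ *-monoˡ-≤ w often ⟩
    suc K * size k * w   ≡⟨ *-assoc (suc K) (size k) w ⟩
    suc K * (size k * w) ≡⟨ cong (suc K *_) (*-comm (size k) w) ⟩
    suc K * (w * size k) ≡⟨ sym (*-assoc (suc K) w (size k)) ⟩
    suc K * w * size k   ≤⟨ *-monoˡ-≤ (size k) le ⟩
    suc n * size k       ∎
    where open ≤-Reasoning

inU-∈ : ∀ {n} {U : Subset n} {x} → x ∈ U → inU U x ≡ 1
inU-∈ {U = U} {x} x∈U with lookup U x | []=⇒lookup x∈U
... | true | _ = refl

inU-∉ : ∀ {n} {U : Subset n} {x} → x ∉ U → inU U x ≡ 0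
inU-∉ {U = U} {x} x∉U with lookup U x in eq
... | true  = contradiction (lookup⇒[]= x U eq) x∉U
... | false = refl

meet-≡ : ∀ {n} (U : Subset n) {x y z a b c} → inU U x ≡ a → inU U y ≡ b → inU U z ≡ c → meet U x y z ≡ a + b + c
meet-≡ U refl refl refl = refl

element : ∀ {n} (U : Subset n) → 1 ≤ ∣ U ∣ → ∃ (_∈ U)
element {n} U 1≤U with nonempty? U
... | yes p = p
... | no ¬p = contradiction (subst (1 ≤_) (trans (cong ∣_∣ (Empty-unique ¬p)) (∣⊥∣≡0 n)) 1≤U) λ ()

non-element : ∀ {n} (U : Subset n) → ∣ U ∣ < n → ∃ (_∉ U)
non-element {n} U U<n with any? (λ x → ¬? (x ∈? U))
... | yes p = p
... | no ¬p = contradiction U<n (<-irrefl (trans (cong ∣_∣ U≡⊤) (∣⊤∣≡n n)))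
  where
  U≡⊤ : U ≡ ⊤
  U≡⊤ = ⊆-antisym ⊆⊤ (λ {x} _ → decidable-stable (x ∈? U) (λ x∉U → ¬p (x , x∉U)))

collapse-≤ : ∀ {G U H} → IsCollapse G U H → V H ≤ V G
collapse-≤ {G} {U} {H} (π , surj , _) = injective⇒≤ {f = λ h → proj₁ (surj h)}
  λ {a} {b} eq → trans (sym (proj₂ (surj a) refl)) (trans (cong π eq) (proj₂ (surj b) refl))

injective-missing-< : ∀ {m n} {f : Fin m → Fin n} → Injective _≡_ _≡_ f → (∃ λ y → ∀ x → f x ≢ y) → m < n
injective-missing-< {m} {n} {f} f-inj (y₀ , missed) = injective⇒≤ {f = f⁺} (λ {x} {y} → f⁺-inj x y)
  where
  f⁺ : Fin (suc m) → Fin n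
  f⁺ zero    = y₀
  f⁺ (suc x) = f x
  f⁺-inj : ∀ x y → f⁺ x ≡ f⁺ y → x ≡ y
  f⁺-inj zero    zero    _  = refl
  f⁺-inj zero    (suc y) eq = contradiction (sym eq) (missed y)
  f⁺-inj (suc x) zero    eq = contradiction eq (missed x)
  f⁺-inj (suc x) (suc y) eq = cong suc (f-inj eq)

induced-< : ∀ {G U F} → ∣ U ∣ < V G → IsInduced G U F → V F < V G
induced-< {U = U} U<V (ι , ι-inj , ι∈U , _) =
  let x₀ , x₀∉U = non-element U U<V
  in injective-missing-< ι-inj (x₀ , λ j eq → x₀∉U (subst (_∈ U) eq (ι∈U j)))

collapsed-vertex : ∀ {G H F} → Reducible G H F → Fin (V H)
collapsed-vertex (U , (2≤U , _) , (π , _) , _) = π (proj₁ (element U (≤-trans (s≤s z≤n) 2≤U)))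

-- Glue the copy of `F` to the common part `rest` of the copies of `H`. An edge inside `U` is seen
-- in `F`; an edge with one vertex in `U` lies in the copy of `H` through the image of that vertex;
-- an edge avoiding `U` lies in all of them; two vertices in `U` are excluded by collapsibility.
expand-copy : ∀ {G H F} (r : Reducible G H F) {N q w} (c : Colouring N q) {i : Fin q}
  (pts : Fin w → Fin N) (rest : Fin (V H) → Fin N) (φ : Fin w → Fin (V H) → Fin N) →
  Injective _≡_ _≡_ pts →
  (∀ a → Injective _≡_ _≡_ (φ a)) →
  (∀ a → φ a (collapsed-vertex {G} {H} {F} r) ≡ pts a) →
  (∀ a v → v ≢ collapsed-vertex {G} {H} {F} r → φ a v ≡ rest v) →
  (∀ a x y z → Edge H x y z → col c (φ a x) (φ a y) (φ a z) ≡ i) →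
  MonoCopy F (pull pts c) i → MonoCopy G c i
expand-copy {G} {H} {F} (U , (2≤U , U<V , no2) , (π , surj , out , inn , sep , _ , fwd) , (ι , ι-inj , ι∈U , onto , E≡))
  {N} {w = w} c {i} pts rest φ pts-inj φ-inj φ-star φ-rest φ-mono (θ , θ-inj , θ-mono) =
  Φ , (λ {x} {y} → Φ-inj x y) , Φ-mono
  where
  u₀ = proj₁ (element U (≤-trans (s≤s z≤n) 2≤U))
  u₀∈U = proj₂ (element U (≤-trans (s≤s z≤n) 2≤U))
  at : ∀ x → x ∈ U → Fin w
  at x x∈U = θ (proj₁ (onto x x∈U))
  Φ : Fin (V G) → Fin N
  Φ x with x ∈? U
  ... | yes x∈U = pts (at x x∈U)
  ... | no  _   = rest (π x)
  Φ-in : ∀ {x} → x ∈ U → ∃ λ j → ι j ≡ x × Φ x ≡ pts (θ j) × Φ x ≡ φ (θ j) (π x)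
  Φ-in {x} x∈U with x ∈? U
  ... | yes p = proj₁ (onto x p) , proj₂ (onto x p) , refl , trans (sym (φ-star (at x p))) (cong (φ (at x p)) (inn u₀ x u₀∈U p))
  ... | no ¬p = contradiction x∈U ¬p
  Φ-out : ∀ {x} → x ∉ U → ∀ a → Φ x ≡ φ a (π x)
  Φ-out {x} x∉U a with x ∈? U
  ... | yes p = contradiction p x∉U
  ... | no ¬p = sym (φ-rest a (π x) (sep x u₀ x∉U u₀∈U))
  Φ-inj : ∀ x y → Φ x ≡ Φ y → x ≡ y
  Φ-inj x y eq with x ∈? U | y ∈? U
  ... | yes p | yes p′ = trans (sym (proj₂ (onto x p))) (trans (cong ι (θ-inj (pts-inj eq))) (proj₂ (onto y p′)))
  ... | yes p | no ¬p  = contradiction (φ-inj (at x p) {π y} {π u₀}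
                           (trans (φ-rest (at x p) (π y) (sep y u₀ ¬p u₀∈U)) (trans (sym eq) (sym (φ-star (at x p)))))) (sep y u₀ ¬p u₀∈U)
  ... | no ¬p | yes p  = contradiction (φ-inj (at y p) {π x} {π u₀}
                           (trans (φ-rest (at y p) (π x) (sep x u₀ ¬p u₀∈U)) (trans eq (sym (φ-star (at y p)))))) (sep x u₀ ¬p u₀∈U)
  ... | no ¬p | no ¬p′ = out x y ¬p ¬p′ (φ-inj (at u₀ u₀∈U)
                           (trans (φ-rest _ (π x) (sep x u₀ ¬p u₀∈U)) (trans eq (sym (φ-rest _ (π y) (sep y u₀ ¬p′ u₀∈U))))))
  viaH : ∀ a {x y z n} → Edge G x y z → meet U x y z ≡ n → n ≢ 3 →
         Φ x ≡ φ a (π x) → Φ y ≡ φ a (π y) → Φ z ≡ φ a (π z) → col c (Φ x) (Φ y) (Φ z) ≡ i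
  viaH a e m n≢3 ex ey ez = trans (cong₃ (col c) ex ey ez) (φ-mono a _ _ _ (fwd _ _ _ e (n≢3 ∘ trans (sym m))))
  Φ-mono : ∀ x y z → Edge G x y z → col c (Φ x) (Φ y) (Φ z) ≡ i
  Φ-mono x y z e = cases (x ∈? U) (y ∈? U) (z ∈? U)
    where
    cases : Dec (x ∈ U) → Dec (y ∈ U) → Dec (z ∈ U) → col c (Φ x) (Φ y) (Φ z) ≡ i
    cases (yes p) (yes p′) (yes p″) with Φ-in p | Φ-in p′ | Φ-in p″
    ... | j , refl , ex , _ | j′ , refl , ey , _ | j″ , refl , ez , _ =
      trans (cong₃ (col c) ex ey ez) (θ-mono j j′ j″ (trans (E≡ j j′ j″) e))
    cases (yes p) (yes p′) (no p″) = contradiction (meet-≡ U (inU-∈ p) (inU-∈ p′) (inU-∉ p″)) (no2 x y z e)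
    cases (yes p) (no p′) (yes p″) = contradiction (meet-≡ U (inU-∈ p) (inU-∉ p′) (inU-∈ p″)) (no2 x y z e)
    cases (no p) (yes p′) (yes p″) = contradiction (meet-≡ U (inU-∉ p) (inU-∈ p′) (inU-∈ p″)) (no2 x y z e)
    cases (yes p) (no p′) (no p″) = let j , _ , _ , ex = Φ-in p in
      viaH (θ j) e (meet-≡ U (inU-∈ p) (inU-∉ p′) (inU-∉ p″)) (λ ()) ex (Φ-out p′ _) (Φ-out p″ _)
    cases (no p) (yes p′) (no p″) = let j , _ , _ , ey = Φ-in p′ in
      viaH (θ j) e (meet-≡ U (inU-∉ p) (inU-∈ p′) (inU-∉ p″)) (λ ()) (Φ-out p _) ey (Φ-out p″ _)
    cases (no p) (no p′) (yes p″) = let j , _ , _ , ez = Φ-in p″ in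
      viaH (θ j) e (meet-≡ U (inU-∉ p) (inU-∉ p′) (inU-∈ p″)) (λ ()) (Φ-out p _) (Φ-out p′ _) ez
    cases (no p) (no p′) (no p″) =
      -- Any copy of `H` would serve; `u₀` supplies an index that exists.
      viaH (at u₀ u₀∈U) e (meet-≡ U (inU-∉ p) (inU-∉ p′) (inU-∉ p″)) (λ ()) (Φ-out p _) (Φ-out p′ _) (Φ-out p″ _)

-- The outermost step of a membership proof. Either way there is a 3-graph of rank `suc ℓ` to look
-- for, `G` itself or the collapsed `H`, and the inductive hypothesis can find it.
data Head (ℓ : ℕ) (G : 3Graph) : Set where
  base : InU (suc ℓ) G → Head ℓ G
  node : ∀ {H F} → Reducible G H F → InU (suc ℓ) H → InU (suc (suc ℓ)) F → Head ℓ G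

head : ∀ {ℓ G} → InU (suc (suc ℓ)) G → Head ℓ G
head (up u)      = base u
head (red r h f) = node r h f

headGraph : ∀ {ℓ G} → Head ℓ G → 3Graph
headGraph {G = G} (base _)     = G
headGraph (node {H} _ _ _) = H

headGraph-InU : ∀ {ℓ G} (d : Head ℓ G) → InU (suc ℓ) (headGraph d)
headGraph-InU (base u)     = u
headGraph-InU (node _ h _) = h

headGraph-≤ : ∀ {ℓ G} (d : Head ℓ G) → V (headGraph d) ≤ V G
headGraph-≤ (base _) = ≤-refl
headGraph-≤ {G = G} (node {H} (U , _ , collapse , _) _ _) = collapse-≤ {G} {U} {H} collapse

sum-update-< : ∀ {A : Set} {n} (f : A → ℕ) (T : Fin n → A) i {b} → f b < f (T i) →
               sum (f ∘ updateAt T i (const b)) < sum (f ∘ T)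
sum-update-< f T zero    lt = +-monoˡ-< (sum (f ∘ T ∘ suc)) lt
sum-update-< f T (suc i) lt = +-monoʳ-< (f (T zero)) (sum-update-< f (T ∘ suc) i lt)

≤-sum : ∀ {n} (f : Fin n → ℕ) i → f i ≤ sum f
≤-sum f zero    = m≤m+n _ _
≤-sum f (suc i) = ≤-trans (≤-sum (f ∘ suc) i) (m≤n+m _ _)

-- Targets of different sizes must share one type of labels, so an embedding is filled up to `v`
-- entries with the dummy `r₀`.
pad : ∀ {m v R} → Fin R → (Fin m → Fin R) → Fin v → Fin R
pad {m} r₀ ψ j with toℕ j <? m
... | yes j<m = ψ (fromℕ< j<m)
... | no  _   = r₀

pad-inject≤ : ∀ {m v R} (r₀ : Fin R) (ψ : Fin m → Fin R) (m≤v : m ≤ v) → pad r₀ ψ ∘ (λ x → inject≤ x m≤v) ≗ ψ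
pad-inject≤ {m} r₀ ψ m≤v x with toℕ (inject≤ x m≤v) <? m
... | yes p = cong ψ (toℕ-injective (trans (toℕ-fromℕ< p) (toℕ-inject≤ x m≤v)))
... | no ¬p = contradiction (subst (_< m) (sym (toℕ-inject≤ x m≤v)) (toℕ<n x)) ¬p

-- The parameter `arrows` is the inductive hypothesis, applied to each transversal of `R` blocks.
-- `K` counts the labels: a colour with an embedding into the blocks.
module Iterate (ℓ v q R : ℕ) (1≤q : 1 ≤ q) (1≤R : 1 ≤ R)
  (arrows : (T : Fin q → 3Graph) → (∀ i → V (T i) ≤ v) → (∀ i → InU (suc ℓ) (T i)) →
            (c : Colouring R q) → ∃ λ i → MonoCopy (T i) c i) where

  K = q * R ^ v
  open Code q v R

  1≤K : 1 ≤ K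
  1≤K = *-mono-≤ 1≤q (1≤^ v 1≤R)

  r₀ : Fin R
  r₀ = fromℕ< 1≤R

  Target : Set
  Target = Σ 3Graph λ G → V G ≤ v × InU (suc (suc ℓ)) G

  -- The block to vary is the one holding the collapsed vertex. In the base case one copy is already
  -- enough and `r₀` is arbitrary.
  direction : ∀ {G} (d : Head ℓ G) → (Fin (V (headGraph d)) → Fin R) → Fin R
  direction (base _)                 ψ = r₀
  direction {G} (node {H} {F} r _ _) ψ = ψ (collapsed-vertex {G} {H} {F} r)

  module Step (T : Fin q → Target) {N} (c : Colouring N q) (w : ℕ) (1≤w : 1 ≤ w) (le : R * (K * w) ≤ N) where

    n = K * w

    β : Fin R → Fin n → Fin N
    β r a = inject≤ (combine r a) le

    β-inj : ∀ r a r′ a′ → β r a ≡ β r′ a′ → r ≡ r′ × a ≡ a′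
    β-inj r a r′ a′ eq = combine-injective r a r′ a′ (inject≤-injective le le _ _ eq)

    heads : ∀ i → Head ℓ (proj₁ (T i))
    heads i = head (proj₂ (proj₂ (T i)))

    T′ : Fin q → 3Graph
    T′ i = headGraph (heads i)

    T′≤v : ∀ i → V (T′ i) ≤ v
    T′≤v i = ≤-trans (headGraph-≤ (heads i)) (proj₁ (proj₂ (T i)))

    vertices : Vec (Fin n) R → Fin R → Fin N
    vertices x r = β r (lookup x r)

    ψ : Fin K → ∀ i → Fin (V (T′ i)) → Fin R
    ψ k i y = support k (inject≤ y (T′≤v i))

    IsCopy : ∀ G → Fin q → Vec (Fin n) R → (Fin (V G) → Fin R) → Set
    IsCopy G i x g = Injective _≡_ _≡_ g × (∀ a b e → Edge G a b e →
                       col c (vertices x (g a)) (vertices x (g b)) (vertices x (g e)) ≡ i)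

    Labelled : Vec (Fin n) R → Fin K → Set
    Labelled x k = IsCopy (T′ (colour k)) (colour k) x (ψ k (colour k))

    labelled : ∀ x → ∃ (Labelled x)
    labelled x with i , g , g-inj , g-mono ← arrows T′ T′≤v (λ i → headGraph-InU (heads i)) (pull (vertices x) c) =
      k , subst (λ j → IsCopy (T′ j) j x (ψ k j)) (sym (colour-code i (pad r₀ g)))
        ( (λ {a} {b} eq → g-inj (trans (sym (ψ≗g a)) (trans eq (ψ≗g b))))
        , λ a b e h → trans (cong₃ (λ a b e → col c (vertices x a) (vertices x b) (vertices x e)) (ψ≗g a) (ψ≗g b) (ψ≗g e)) (g-mono a b e h) )
      where
      k = code i (pad r₀ g)
      ψ≗g : ψ k i ≗ g
      ψ≗g y = trans (support-code i (pad r₀ g) _) (pad-inject≤ r₀ g (T′≤v i) y)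

    towards : Fin K → Fin R
    towards k = direction (heads (colour k)) (ψ k (colour k))

    label : Vec (Fin n) R → Fin K
    label x = proj₁ (labelled x)

    Copies : Set
    Copies = ∃ λ i → ∃ λ (f : Fin (V (T′ i)) → Fin R) → ∃ λ x → ∃ λ (g : Fin w → Fin n) →
      Injective _≡_ _≡_ g × (∀ a → IsCopy (T′ i) i (x [ direction (heads i) f ]≔ g a) f)

    popular-copies : Copies
    popular-copies = read (popular-line w label towards (*-mono-≤ 1≤K 1≤w) 1≤K ≤-refl)
      where
      read : (∃ λ k → ∃ λ x → ∃ λ (g : Fin w → Fin n) → Injective _≡_ _≡_ g × (∀ a → label (x [ towards k ]≔ g a) ≡ k)) → Copies
      read (k , x , g , g-inj , eq) = colour k , ψ k (colour k) , x , g , g-inj , copy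
        where
        copy : ∀ a → Labelled (x [ towards k ]≔ g a) k
        copy a = subst (Labelled (x [ towards k ]≔ g a)) (eq a) (proj₂ (labelled (x [ towards k ]≔ g a)))

    module Node {G H F} (r : Reducible G H F) (i : Fin q) (f : Fin (V H) → Fin R) (x : Vec (Fin n) R)
      (g : Fin w → Fin n) (g-inj : Injective _≡_ _≡_ g) where

      j = f (collapsed-vertex {G} {H} {F} r)

      pts : Fin w → Fin N
      pts a = β j (g a)

      pts-inj : Injective _≡_ _≡_ pts
      pts-inj eq = g-inj (proj₂ (β-inj _ _ _ _ eq))

      expand : (∀ a → IsCopy H i (x [ j ]≔ g a) f) → MonoCopy F (pull pts c) i → MonoCopy G c i
      expand copy = expand-copy {G} {H} {F} r c pts (λ y → vertices x (f y)) (λ a y → vertices (x [ j ]≔ g a) (f y)) pts-inj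
        (λ a eq → proj₁ (copy a) (proj₁ (β-inj _ _ _ _ eq)))
        (λ a → cong (β j) (lookup∘update j x (g a)))
        (λ a y y≢ → cong (β (f y)) (lookup∘update′ (y≢ ∘ proj₁ (copy a)) x (g a)))
        (λ a → proj₂ (copy a))

  -- `p` bounds the total size of the targets. A round either succeeds or replaces the target of one
  -- colour by a smaller 3-graph, at the cost of a factor `R * K` in the number of points.
  iterate : ∀ p (T : Fin q → Target) → sum (V ∘ proj₁ ∘ T) ≤ p →
            ∀ {N} (c : Colouring N q) → (R * K) ^ suc p ≤ N → ∃ λ i → MonoCopy (proj₁ (T i)) c i
  iterate p T ΣV≤p {N} c le = let i , f , x , g , g-inj , copies = popular-copies in resolve i (heads i) f x g g-inj copies
    where
    w = (R * K) ^ p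
    1≤w : 1 ≤ w
    1≤w = 1≤^ p (*-mono-≤ 1≤R 1≤K)
    open Step T c w 1≤w (≤-trans (≤-reflexive (sym (*-assoc R K w))) le)
    resolve : ∀ i (d : Head ℓ (proj₁ (T i))) (f : Fin (V (headGraph d)) → Fin R) x (g : Fin w → Fin n) →
      Injective _≡_ _≡_ g → (∀ a → IsCopy (headGraph d) i (x [ direction d f ]≔ g a) f) →
      ∃ λ i′ → MonoCopy (proj₁ (T i′)) c i′
    resolve i (base _) f x g g-inj copies =
      let f-inj , mono = copies (fromℕ< 1≤w)
      in i , vertices (x [ r₀ ]≔ g (fromℕ< 1≤w)) ∘ f , (λ eq → f-inj (proj₁ (β-inj _ _ _ _ eq))) , mono
    resolve i (node {H} {F} r@(U , (_ , U<V , _) , _ , induced) _ F∈U) f x g g-inj copies = recurse p refl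
      where
      open Node {proj₁ (T i)} {H} {F} r i f x g g-inj
      F<G : V F < V (proj₁ (T i))
      F<G = induced-< {proj₁ (T i)} {U} {F} U<V induced
      F′ : Target
      F′ = F , ≤-trans (<⇒≤ F<G) (proj₁ (proj₂ (T i))) , F∈U
      -- Only colour `i` has a new target, and there a copy of `F` expands to the old one; copies in
      -- other colours are just moved back along `pts`.
      lift : ∀ i′ → MonoCopy (proj₁ (updateAt T i (const F′) i′)) (pull pts c) i′ → MonoCopy (proj₁ (T i′)) c i′
      lift i′ copy with i′ ≟ i
      ... | yes refl = expand copies (subst (λ G → MonoCopy G (pull pts c) i) (cong proj₁ (updateAt-updates i T)) copy)
      ... | no i′≢i  = push-copy (proj₁ (T i′)) pts pts-inj c
                         (subst (λ G → MonoCopy G (pull pts c) i′) (cong proj₁ (updateAt-minimal i′ i T i′≢i)) copy)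
      recurse : ∀ p′ → p ≡ p′ → ∃ λ i′ → MonoCopy (proj₁ (T i′)) c i′
      -- Without budget every target is empty, whereas this one has more vertices than `F`.
      recurse zero refl = contradiction (≤-trans (≤-sum (V ∘ proj₁ ∘ T) i) ΣV≤p) (<⇒≱ (≤-<-trans z≤n F<G))
      recurse (suc p′) refl =
        let i′ , copy = iterate p′ (updateAt T i (const F′))
                          (≤-pred (≤-trans (sum-update-< (V ∘ proj₁) T i F<G) ΣV≤p)) (pull pts c) ≤-refl
        in i′ , lift i′ copy

-- Upper bounds

^-monoʳ : ∀ {b a a′} → 1 ≤ b → a ≤ a′ → b ^ a ≤ b ^ a′
^-monoʳ {suc b} _ = ^-monoʳ-≤ (suc b)

*-≤-^ : ∀ b {x y} a a′ → x ≤ b ^ a → y ≤ b ^ a′ → x * y ≤ b ^ (a + a′)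
*-≤-^ b a a′ p q = ≤-trans (*-mono-≤ p q) (≤-reflexive (sym (^-distribˡ-+-* b a a′)))

^-≤-^ : ∀ b {x} a m → x ≤ b ^ a → x ^ m ≤ b ^ (a * m)
^-≤-^ b a m p = ≤-trans (^-monoˡ-≤ m p) (≤-reflexive (^-*-assoc b a m))

+-≤-^ : ∀ b → 2 ≤ b → ∀ {x y} a a′ → x ≤ b ^ a → y ≤ b ^ a′ → x + y ≤ b ^ (1 + (a + a′))
+-≤-^ b 2≤b {x} {y} a a′ p q = begin
  x + y                         ≤⟨ +-mono-≤ (≤-trans p (^-monoʳ 1≤b (m≤m+n a a′))) (≤-trans q (^-monoʳ 1≤b (m≤n+m a′ a))) ⟩
  b ^ (a + a′) + b ^ (a + a′)   ≡⟨ cong (b ^ (a + a′) +_) (sym (+-identityʳ _)) ⟩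
  2 * b ^ (a + a′)              ≤⟨ *-monoˡ-≤ (b ^ (a + a′)) 2≤b ⟩
  b ^ (1 + (a + a′))            ∎
  where
  open ≤-Reasoning
  1≤b = ≤-trans (s≤s z≤n) 2≤b

n≤2^n : ∀ n → n ≤ 2 ^ n
n≤2^n zero    = z≤n
n≤2^n (suc n) = +-mono-≤ (1≤^ {2} n (s≤s z≤n)) (≤-trans (n≤2^n n) (≤-reflexive (sym (+-identityʳ _))))

1≤log₂ : ∀ {q} → 2 ≤ q → 1 ≤ log₂ q
1≤log₂ = ⌊log₂⌋-mono-≤

-- Rounding down loses less than 1, which a second `log₂ q ≥ 1` makes up for.
≤-2^log₂ : ∀ {q} → 2 ≤ q → q ≤ 2 ^ (2 * log₂ q)
≤-2^log₂ {q} 2≤q with q ≤? 2 ^ (1 + log₂ q)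
... | yes p = ≤-trans p (^-monoʳ-≤ 2 (+-mono-≤ (1≤log₂ 2≤q) (≤-reflexive (sym (+-identityʳ _)))))
... | no ¬p = contradiction (≤-trans (≤-reflexive (sym (⌊log₂[2^n]⌋≡n (1 + log₂ q)))) (⌊log₂⌋-mono-≤ (<⇒≤ (≰⇒> ¬p)))) 1+n≰n

log₂≤ : ∀ q → 1 ≤ q → log₂ q ≤ q
log₂≤ q 1≤q = ≤-trans (⌊log₂⌋-mono-≤ (n≤2^n q)) (≤-reflexive (⌊log₂[2^n]⌋≡n q))

-- The constant depends on `v` alone, so it survives the replacement of targets by smaller ones
-- during the iteration.
OffDiagonal : ℕ → Set
OffDiagonal ℓ = ∀ v → ∃ λ C → ∀ q → 2 ≤ q → (T : Fin q → 3Graph) →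
  (∀ i → V (T i) ≤ v) → (∀ i → InU (suc ℓ) (T i)) →
  ∀ {N} (c : Colouring N q) → 2 ^ (C * q ^ suc ℓ * log₂ q) ≤ N → ∃ λ i → MonoCopy (T i) c i

star-size-bound : ∀ v → ∃ λ C → ∀ q → 2 ≤ q → star-size v q ≤ 2 ^ (C * q ^ 1 * log₂ q)
-- The coefficients collect the exponents after `1 ≤ q * L`, `L ≤ q * L` and `2 * L + 1 ≤ L * 3`.
star-size-bound v = 3 + v * 3 + v * v * 3 + v , λ q 2≤q →
  let L = log₂ q
      q≤ = ≤-2^log₂ 2≤q
      r = (2 * L + 1) * (q * v)
      R≤ : (q * 2) ^ (q * v) ≤ 2 ^ r
      R≤ = ^-≤-^ 2 (2 * L + 1) (q * v) (*-≤-^ 2 (2 * L) 1 q≤ ≤-refl)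
      e = 2 * L + r * v + v
      size≤ = +-≤-^ 2 (s≤s (s≤s z≤n)) e r (*-≤-^ 2 (2 * L + r * v) v (*-≤-^ 2 (2 * L) (r * v) q≤ (^-≤-^ 2 r v R≤)) (n≤2^n v)) R≤
  in ≤-trans size≤ (^-monoʳ-≤ 2 (exponent q L (≤-trans (s≤s z≤n) 2≤q) (1≤log₂ 2≤q)))
  where
  open ≤-Reasoning
  ring : ∀ v q L → q * L + (2 * (q * L) + (L * 3) * (q * v) * v + v * (q * L) + (L * 3) * (q * v))
                 ≡ (3 + v * 3 + v * v * 3 + v) * (q * 1) * L
  ring = solve-∀
  exponent : ∀ q L → 1 ≤ q → 1 ≤ L →
    1 + (2 * L + (2 * L + 1) * (q * v) * v + v + (2 * L + 1) * (q * v)) ≤ (3 + v * 3 + v * v * 3 + v) * q ^ 1 * L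
  exponent q L 1≤q 1≤L = begin
    1 + (2 * L + (2 * L + 1) * (q * v) * v + v + (2 * L + 1) * (q * v))
      ≤⟨ +-mono-≤ qL (+-mono-≤ (+-mono-≤ (+-mono-≤ (*-monoʳ-≤ 2 LL) (*-monoˡ-≤ v (*-monoˡ-≤ (q * v) 3L)))
           (≤-trans (≤-reflexive (sym (*-identityʳ v))) (*-monoʳ-≤ v qL))) (*-monoˡ-≤ (q * v) 3L)) ⟩
    q * L + (2 * (q * L) + (L * 3) * (q * v) * v + v * (q * L) + (L * 3) * (q * v))
      ≡⟨ ring v q L ⟩
    (3 + v * 3 + v * v * 3 + v) * q ^ 1 * L ∎
    where
    qL : 1 ≤ q * L
    qL = *-mono-≤ 1≤q 1≤L
    LL : L ≤ q * L
    LL = ≤-trans (≤-reflexive (sym (*-identityˡ L))) (*-monoˡ-≤ L 1≤q)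
    3L : 2 * L + 1 ≤ L * 3
    3L = ≤-trans (+-monoʳ-≤ (2 * L) 1≤L) (≤-reflexive (lem L))
      where
      lem : ∀ L → 2 * L + L ≡ L * 3
      lem = solve-∀

-- With `R = 2 ^ r` from the previous rank, `R * K` has exponent at most `r + 2 * L + r * v`, and
-- there are at most `q * v + 1` rounds. The product of these two is the new exponent.
off-diagonal : ∀ ℓ → OffDiagonal ℓ
off-diagonal zero v = proj₁ (star-size-bound v) , λ q 2≤q T V≤v T∈U c le →
  let k , copies = transversal-arrows (≤-trans (s≤s z≤n) 2≤q) c (≤-trans (proj₂ (star-size-bound v) q 2≤q) le)
  in k , copies (T k) (V≤v k) (transversal (T∈U k))
  where
  transversal : ∀ {G} → InU 1 G → OneTransversal G
  transversal (InU.trans t) = t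
off-diagonal (suc ℓ) v with C , arrows ← off-diagonal ℓ v = (C + 2 + C * v) * (1 + v) , λ q 2≤q T V≤v T∈U c le →
  let L = log₂ q
      r = C * q ^ suc ℓ * L
      1≤q = ≤-trans (s≤s z≤n) 2≤q
      open Iterate ℓ v q (2 ^ r) 1≤q (1≤^ r (s≤s z≤n)) (λ T V≤v T∈U c → arrows q 2≤q T V≤v T∈U c ≤-refl)
      B≤ : 2 ^ r * (q * (2 ^ r) ^ v) ≤ 2 ^ (r + (2 * L + r * v))
      B≤ = *-≤-^ 2 r (2 * L + r * v) ≤-refl (*-≤-^ 2 (2 * L) (r * v) (≤-2^log₂ 2≤q) (^-≤-^ 2 r v ≤-refl))
      size≤ = ≤-trans (^-≤-^ 2 (r + (2 * L + r * v)) (suc (q * v)) B≤)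
                (^-monoʳ-≤ 2 (exponent q L (q ^ suc ℓ) 1≤q (1≤^ (suc ℓ) 1≤q)))
  in iterate (q * v) (λ i → T i , V≤v i , T∈U i) (≤-trans (sum-mono-≤ V≤v) (≤-reflexive (sum-const q v))) c (≤-trans size≤ le)
  where
  open ≤-Reasoning
  ring : ∀ C v q L Y → (C * Y * L + (2 * (Y * L) + C * Y * L * v)) * (q + q * v) ≡ (C + 2 + C * v) * (1 + v) * (q * Y) * L
  ring = solve-∀
  exponent : ∀ q L Y → 1 ≤ q → 1 ≤ Y →
    (C * Y * L + (2 * L + C * Y * L * v)) * suc (q * v) ≤ (C + 2 + C * v) * (1 + v) * (q * Y) * L
  exponent q L Y 1≤q 1≤Y = begin
    (C * Y * L + (2 * L + C * Y * L * v)) * suc (q * v)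
      ≤⟨ *-mono-≤ (+-monoʳ-≤ (C * Y * L) (+-monoˡ-≤ (C * Y * L * v) (*-monoʳ-≤ 2
           (≤-trans (≤-reflexive (sym (*-identityˡ L))) (*-monoˡ-≤ L 1≤Y))))) (+-monoˡ-≤ (q * v) 1≤q) ⟩
    (C * Y * L + (2 * (Y * L) + C * Y * L * v)) * (q + q * v)
      ≡⟨ ring C v q L Y ⟩
    (C + 2 + C * v) * (1 + v) * (q * Y) * L ∎

-- Once `t ≤ q`, each factor `t` counts as a power of `q`, and the final exponent depends on `t`
-- only.
tripartite-size-bound : ∀ t → ∃ λ C → ∀ q → 2 ≤ q → t ≤ q → tripartite-size t q ≤ q ^ C
tripartite-size-bound t = 1 + (2 + (1 + ((a + 1) + (a′ + 1)))) , λ q 2≤q t≤q →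
  let q≤ : q ≤ q ^ 1
      q≤ = ≤-reflexive (sym (^-identityʳ q))
      t≤ = ≤-trans t≤q q≤
      Q≤ : labels t q ≤ q ^ a
      Q≤ = *-≤-^ q 1 (2 * t) q≤ (^-≤-^ q 2 t (*-≤-^ q 1 1 q≤ t≤))
      Q′≤ : labels t (labels t q) ≤ q ^ a′
      Q′≤ = *-≤-^ q a ((a + 1) * t) Q≤ (^-≤-^ q (a + 1) t (*-≤-^ q a 1 Q≤ t≤))
  in +-≤-^ q 2≤q 2 (1 + ((a + 1) + (a′ + 1))) (*-≤-^ q 1 1 q≤ t≤)
       (+-≤-^ q 2≤q (a + 1) (a′ + 1) (*-≤-^ q a 1 Q≤ t≤) (*-≤-^ q a′ 1 Q′≤ t≤))
  where
  a = 1 + 2 * t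
  a′ = a + (a + 1) * t

clique-size : ℕ → ℕ → ℕ
clique-size t q = let M = (q * 2) ^ (q * t) in (q ^ M * 2) ^ M

clique-arrows : ∀ G {q N} → 1 ≤ q → clique-size (V G) q ≤ N → Arrows G q N
clique-arrows G {suc q} _ le c =
  let k , g , g-inj , mono = clique₃ (V G) c le
  in k , g , g-inj , λ x y z e → mono x y z (edge-≢₁₂ G e) (edge-≢₂₃ G e) (edge-≢₁₃ G e)

clique-size-bound : ∀ t → ∃ λ C → ∀ q → 2 ≤ q → clique-size t q ≤ 2 ^ (2 ^ (C * q * log₂ q))
-- `M` enters the exponent twice, each time with `m ≤ 3 * q * L * t`; the remaining `2 + L` is at
-- most `3 * q * L`.
clique-size-bound t = 3 + t * 6 , λ q 2≤q →
  let L = log₂ q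
      m = (2 * L + 1) * (q * t)
      M = (q * 2) ^ (q * t)
      M≤ : M ≤ 2 ^ m
      M≤ = ^-≤-^ 2 (2 * L + 1) (q * t) (*-≤-^ 2 (2 * L) 1 (≤-2^log₂ 2≤q) ≤-refl)
      N≤ : clique-size t q ≤ 2 ^ ((2 * L * M + 1) * M)
      N≤ = ^-≤-^ 2 (2 * L * M + 1) M (*-≤-^ 2 (2 * L * M) 1 (^-≤-^ 2 (2 * L) M (≤-2^log₂ 2≤q)) ≤-refl)
      e≤ : (2 * L * M + 1) * M ≤ 2 ^ (1 + (1 + L + m + 0) + m)
      e≤ = *-≤-^ 2 (1 + (1 + L + m + 0)) m
             (+-≤-^ 2 ≤-refl (1 + L + m) 0 (*-≤-^ 2 (1 + L) m (*-≤-^ 2 1 L ≤-refl (n≤2^n L)) M≤) ≤-refl) M≤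
  in ≤-trans N≤ (^-monoʳ-≤ 2 (≤-trans e≤ (^-monoʳ-≤ 2 (exponent q L (≤-trans (s≤s z≤n) 2≤q) (1≤log₂ 2≤q)))))
  where
  open ≤-Reasoning
  ring₁ : ∀ q L t → 1 + (1 + L + (2 * L + 1) * (q * t) + 0) + (2 * L + 1) * (q * t) ≡ 2 + L + 2 * ((2 * L + 1) * (q * t))
  ring₁ = solve-∀
  ring₂ : ∀ q L t → 2 * (q * L) + q * L + 2 * ((2 * L + L) * (q * t)) ≡ (3 + t * 6) * q * L
  ring₂ = solve-∀
  exponent : ∀ q L → 1 ≤ q → 1 ≤ L →
    1 + (1 + L + (2 * L + 1) * (q * t) + 0) + (2 * L + 1) * (q * t) ≤ (3 + t * 6) * q * L
  exponent q L 1≤q 1≤L = begin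
    1 + (1 + L + (2 * L + 1) * (q * t) + 0) + (2 * L + 1) * (q * t) ≡⟨ ring₁ q L t ⟩
    2 + L + 2 * ((2 * L + 1) * (q * t))
      ≤⟨ +-mono-≤ (+-mono-≤ (*-monoʳ-≤ 2 (*-mono-≤ 1≤q 1≤L)) (≤-trans (≤-reflexive (sym (*-identityˡ L))) (*-monoˡ-≤ L 1≤q)))
           (*-monoʳ-≤ 2 (*-monoˡ-≤ (q * t) (+-monoʳ-≤ (2 * L) 1≤L))) ⟩
    2 * (q * L) + q * L + 2 * ((2 * L + L) * (q * t)) ≡⟨ ring₂ q L t ⟩
    (3 + t * 6) * q * L ∎

-- Lower bound for 3-graphs with two edges

-- The elementary symmetric polynomials: their values do not depend on the order of a triple, yet
-- determine it, so they give a symmetric colouring without sorting.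
e₁ e₂ e₃ : ℕ → ℕ → ℕ → ℕ
e₁ x y z = x + y + z
e₂ x y z = x * y + y * z + x * z
e₃ x y z = x * y * z

-- a is a root of (T − x)(T − y)(T − z) = (T − a)(T − b)(T − c).
root-of-symmetric : ∀ x y z a b c → e₁ x y z ≡ e₁ a b c → e₂ x y z ≡ e₂ a b c → e₃ x y z ≡ e₃ a b c →
                    a ≡ x ⊎ a ≡ y ⊎ a ≡ z
root-of-symmetric x y z a b c p₁ p₂ p₃ =
  [ (λ XY≡0 → [ inj₁ ∘ root x , inj₂ ∘ inj₁ ∘ root y ]′ (i*j≡0⇒i≡0∨j≡0 X XY≡0)) , inj₂ ∘ inj₂ ∘ root z ]′
    (i*j≡0⇒i≡0∨j≡0 (X *ᶻ Y) vanish)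
  where
  X = pos a -ᶻ pos x
  Y = pos a -ᶻ pos y
  Z = pos a -ᶻ pos z
  poly : ℤ → ℤ → ℤ → ℤ → ℤ
  poly t s₁ s₂ s₃ = t *ᶻ t *ᶻ t -ᶻ s₁ *ᶻ t *ᶻ t +ᶻ s₂ *ᶻ t -ᶻ s₃
  expand : ∀ t x y z → (t -ᶻ x) *ᶻ (t -ᶻ y) *ᶻ (t -ᶻ z) ≡
    t *ᶻ t *ᶻ t -ᶻ (x +ᶻ y +ᶻ z) *ᶻ t *ᶻ t +ᶻ (x *ᶻ y +ᶻ y *ᶻ z +ᶻ x *ᶻ z) *ᶻ t -ᶻ x *ᶻ y *ᶻ z
  expand = ℤ-Solver.solve-∀
  at-root : ∀ t y z → t *ᶻ t *ᶻ t -ᶻ (t +ᶻ y +ᶻ z) *ᶻ t *ᶻ t +ᶻ (t *ᶻ y +ᶻ y *ᶻ z +ᶻ t *ᶻ z) *ᶻ t -ᶻ t *ᶻ y *ᶻ z ≡ pos 0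
  at-root = ℤ-Solver.solve-∀
  σ₂ σ₃ : ℕ → ℕ → ℕ → ℤ
  σ₂ x y z = pos x *ᶻ pos y +ᶻ pos y *ᶻ pos z +ᶻ pos x *ᶻ pos z
  σ₃ x y z = pos x *ᶻ pos y *ᶻ pos z
  e₂ᶻ : ∀ x y z → pos (e₂ x y z) ≡ σ₂ x y z
  e₂ᶻ x y z = cong₂ _+ᶻ_ (cong₂ _+ᶻ_ (pos-* x y) (pos-* y z)) (pos-* x z)
  e₃ᶻ : ∀ x y z → pos (e₃ x y z) ≡ σ₃ x y z
  e₃ᶻ x y z = trans (pos-* (x * y) z) (cong (_*ᶻ pos z) (pos-* x y))
  vanish : X *ᶻ Y *ᶻ Z ≡ pos 0
  vanish = begin
    X *ᶻ Y *ᶻ Z                                              ≡⟨ expand (pos a) (pos x) (pos y) (pos z) ⟩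
    poly (pos a) (pos (e₁ x y z)) (σ₂ x y z) (σ₃ x y z)      ≡⟨ cong₃ (poly (pos a)) (cong pos p₁)
                                                           (trans (sym (e₂ᶻ x y z)) (trans (cong pos p₂) (e₂ᶻ a b c)))
                                                           (trans (sym (e₃ᶻ x y z)) (trans (cong pos p₃) (e₃ᶻ a b c))) ⟩
    poly (pos a) (pos (e₁ a b c)) (σ₂ a b c) (σ₃ a b c)      ≡⟨ at-root (pos a) (pos b) (pos c) ⟩
    pos 0                                                    ∎
    where open ≡-Reasoning
  root : ∀ x → pos a -ᶻ pos x ≡ pos 0 → a ≡ x
  root x eq = +-injective (i-j≡0⇒i≡j (pos a) (pos x) eq)

-- The product of the ranges of `e₁`, `e₂` and `e₃` on numbers below `N`.
palette : ℕ → ℕ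
palette N = 3 * N * (3 * N * N * (N * N * N))

module SymmetricColouring (N q : ℕ) (le : palette N ≤ q) where

  module _ (x y z : Fin N) where
    private
      x≤ = toℕ<n x
      y≤ = toℕ<n y
      z≤ = toℕ<n z

    e₁< : e₁ (toℕ x) (toℕ y) (toℕ z) < 3 * N
    e₁< = ≤-trans (+-mono-<-≤ (+-mono-<-≤ x≤ (<⇒≤ y≤)) (<⇒≤ z≤)) (≤-reflexive (lem N))
      where
      lem : ∀ N → N + N + N ≡ 3 * N
      lem = solve-∀

    e₂< : e₂ (toℕ x) (toℕ y) (toℕ z) < 3 * N * N
    e₂< = ≤-trans (+-mono-<-≤ (+-mono-<-≤ (*-mono-< x≤ y≤) (*-mono-≤ (<⇒≤ y≤) (<⇒≤ z≤))) (*-mono-≤ (<⇒≤ x≤) (<⇒≤ z≤))) (≤-reflexive (lem N))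
      where
      lem : ∀ N → N * N + N * N + N * N ≡ 3 * N * N
      lem = solve-∀

    e₃< : e₃ (toℕ x) (toℕ y) (toℕ z) < N * N * N
    e₃< = *-mono-< (*-mono-< x≤ y≤) z≤

    χ : Fin q
    χ = inject≤ (combine (fromℕ< e₁<) (combine (fromℕ< e₂<) (fromℕ< e₃<))) le

  χ-cong : ∀ x y z x′ y′ z′ → e₁ (toℕ x) (toℕ y) (toℕ z) ≡ e₁ (toℕ x′) (toℕ y′) (toℕ z′) →
    e₂ (toℕ x) (toℕ y) (toℕ z) ≡ e₂ (toℕ x′) (toℕ y′) (toℕ z′) →
    e₃ (toℕ x) (toℕ y) (toℕ z) ≡ e₃ (toℕ x′) (toℕ y′) (toℕ z′) → χ x y z ≡ χ x′ y′ z′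
  χ-cong x y z x′ y′ z′ p₁ p₂ p₃ = cong (λ k → inject≤ k le)
    (cong₂ combine (fromℕ<-cong _ _ p₁ (e₁< x y z) (e₁< x′ y′ z′))
      (cong₂ combine (fromℕ<-cong _ _ p₂ (e₂< x y z) (e₂< x′ y′ z′)) (fromℕ<-cong _ _ p₃ (e₃< x y z) (e₃< x′ y′ z′))))

  χ-injective : ∀ x y z a b c → χ x y z ≡ χ a b c → a ≡ x ⊎ a ≡ y ⊎ a ≡ z
  χ-injective x y z a b c eq =
    let p₁ , p₂₃ = combine-injective (fromℕ< (e₁< x y z)) (combine (fromℕ< (e₂< x y z)) (fromℕ< (e₃< x y z)))
                                     (fromℕ< (e₁< a b c)) (combine (fromℕ< (e₂< a b c)) (fromℕ< (e₃< a b c)))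
                                     (inject≤-injective le le _ _ eq)
        p₂ , p₃ = combine-injective (fromℕ< (e₂< x y z)) (fromℕ< (e₃< x y z)) (fromℕ< (e₂< a b c)) (fromℕ< (e₃< a b c)) p₂₃
    in map toℕ-injective (map toℕ-injective toℕ-injective)
         (root-of-symmetric (toℕ x) (toℕ y) (toℕ z) (toℕ a) (toℕ b) (toℕ c)
           (fromℕ<-injective _ _ (e₁< x y z) (e₁< a b c) p₁)
           (fromℕ<-injective _ _ (e₂< x y z) (e₂< a b c) p₂)
           (fromℕ<-injective _ _ (e₃< x y z) (e₃< a b c) p₃))

  colouring : Colouring N q
  colouring = record
    { col = χ
    ; csym₁₂ = λ x y z → let a = toℕ x ; b = toℕ y ; c = toℕ z in χ-cong x y z y x z (s₁ a b c) (s₂ a b c) (s₃ a b c)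
    ; csym₂₃ = λ x y z → let a = toℕ x ; b = toℕ y ; c = toℕ z in χ-cong x y z x z y (t₁ a b c) (t₂ a b c) (t₃ a b c) }
    where
    s₁ : ∀ a b c → a + b + c ≡ b + a + c
    s₁ = solve-∀
    s₂ : ∀ a b c → a * b + b * c + a * c ≡ b * a + a * c + b * c
    s₂ = solve-∀
    s₃ : ∀ a b c → a * b * c ≡ b * a * c
    s₃ = solve-∀
    t₁ : ∀ a b c → a + b + c ≡ a + c + b
    t₁ = solve-∀
    t₂ : ∀ a b c → a * b + b * c + a * c ≡ a * c + c * b + a * b
    t₂ = solve-∀
    t₃ : ∀ a b c → a * b * c ≡ a * c * b
    t₃ = solve-∀

-- With that many colours, triples of equal colour coincide, but a copy of `G` has an edge with a
-- vertex outside another edge.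
palette-≰ : ∀ G {q N} → AtLeastTwoEdges G → Arrows G q N → ¬ palette N ≤ q
palette-≰ G {q} {N} (x , y , z , a , b , c , e , e′ , a∉) arr le =
  let i , φ , φ-inj , mono = arr colouring
  in a∉ (map φ-inj (map φ-inj φ-inj)
       (χ-injective (φ x) (φ y) (φ z) (φ a) (φ b) (φ c) (trans (mono x y z e) (sym (mono a b c e′)))))
  where open SymmetricColouring N q le

V≤arrows : ∀ G {q N} → 1 ≤ q → Arrows G q N → V G ≤ N
V≤arrows G {suc q} _ arr =
  let _ , _ , φ-inj , _ = arr (record { col = λ _ _ _ → zero ; csym₁₂ = λ _ _ _ → refl ; csym₂₃ = λ _ _ _ → refl })
  in injective⇒≤ φ-inj

2≤V : ∀ G → AtLeastTwoEdges G → 2 ≤ V G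
2≤V G (x , y , z , _ , _ , _ , e , _) = two x y (edge-≢₁₂ G e)
  where
  two : ∀ {n} (x y : Fin n) → x ≢ y → 2 ≤ n
  two {suc zero}    zero zero x≢y = contradiction refl x≢y
  two {suc (suc n)} _    _    _   = s≤s (s≤s z≤n)

polynomial-lower-bound : ∀ G {q N} → AtLeastTwoEdges G → 1 ≤ q → Arrows G q N → q ^ 1 ≤ N ^ 10
polynomial-lower-bound G {q} {N} two 1≤q arr = begin
  q ^ 1            ≡⟨ ^-identityʳ q ⟩
  q                ≤⟨ <⇒≤ (≰⇒> (palette-≰ G two arr)) ⟩
  palette N        ≡⟨ ring₁ N ⟩
  -- `9 ≤ 2 ^ 4 ≤ N ^ 4`, because `N` is at least the number of vertices of `G`.
  9 * N ^ 6        ≤⟨ *-monoˡ-≤ (N ^ 6) (≤-trans (m≤m+n 9 7) (^-monoˡ-≤ 4 (≤-trans (2≤V G two) (V≤arrows G 1≤q arr)))) ⟩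
  N ^ 4 * N ^ 6    ≡⟨ sym (^-distribˡ-+-* N 4 6) ⟩
  N ^ 10           ∎
  where
  open ≤-Reasoning
  ring₁ : ∀ N → 3 * N * (3 * N * N * (N * N * N)) ≡ 9 * (N * (N * (N * (N * (N * (N * 1))))))
  ring₁ = solve-∀

-- Lower bound for non-tripartite 3-graphs

clash : Fin 3 → Fin 3 → Fin 3 → Bool
clash a b c = (a == b) ∨ ((b == c) ∨ (a == c))

clashes : ∀ {n} → Vec (Fin 3) n → Fin n × Fin n × Fin n → Bool
clashes f (x , y , z) = clash (lookup f x) (lookup f y) (lookup f z)

Distinct : ∀ {n} → Fin n × Fin n × Fin n → Set
Distinct (x , y , z) = x ≢ y × y ≢ z × x ≢ z

-- Of the 27 colour patterns on three distinct points, 21 are not rainbow.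
sum-clashes : ∀ {n} (t : Fin n × Fin n × Fin n) → Distinct t → 9 * sumᵛ n (λ f → toNat (clashes f t)) ≡ 7 * 3 ^ n
-- Resampling at `x`, `y` and `z` multiplies the sum by 27 and makes the summand constant; the
-- identity `27 S = 21 * 3 ^ n` is then divided by 3.
sum-clashes {n} (x , y , z) (x≢y , y≢z , x≢z) = *-cancelˡ-≡ (9 * S g) (7 * 3 ^ n) 3 (begin
  3 * (9 * S g)                   ≡⟨ cong (3 *_) (*-assoc 3 3 (S g)) ⟩
  3 * (3 * (3 * S g))             ≡⟨ cong (λ s → 3 * (3 * s)) (sym (sumᵛ-lines n z g)) ⟩
  3 * (3 * S (I z g))             ≡⟨ cong (3 *_) (sym (sumᵛ-lines n y (I z g))) ⟩
  3 * S (I y (I z g))             ≡⟨ sym (sumᵛ-lines n x (I y (I z g))) ⟩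
  S (I x (I y (I z g)))           ≡⟨ sumᵛ-cong n pointwise ⟩
  S (const 21)                    ≡⟨ sumᵛ-const n 21 ⟩
  3 ^ n * 21                      ≡⟨ *-comm (3 ^ n) 21 ⟩
  21 * 3 ^ n                      ≡⟨ *-assoc 3 7 (3 ^ n) ⟩
  3 * (7 * 3 ^ n)                 ∎)
  where
  open ≡-Reasoning
  S = sumᵛ {3} n
  I : Fin n → (Vec (Fin 3) n → ℕ) → Vec (Fin 3) n → ℕ
  I j h f = sum (λ a → h (f [ j ]≔ a))
  g : Vec (Fin 3) n → ℕ
  g f = toNat (clashes f (x , y , z))
  value : ∀ f a b c → g (((f [ x ]≔ a) [ y ]≔ b) [ z ]≔ c) ≡ toNat (clash a b c)
  value f a b c = cong toNat (cong₃ clash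
    (trans (lookup∘update′ x≢z (f [ x ]≔ a [ y ]≔ b) c) (trans (lookup∘update′ x≢y (f [ x ]≔ a) b) (lookup∘update x f a)))
    (trans (lookup∘update′ y≢z (f [ x ]≔ a [ y ]≔ b) c) (lookup∘update y (f [ x ]≔ a) b))
    (lookup∘update z (f [ x ]≔ a [ y ]≔ b) c))
  pointwise : ∀ f → I x (I y (I z g)) f ≡ 21
  pointwise f = sum-cong-≗ {3} (λ a → sum-cong-≗ {3} (λ b → sum-cong-≗ {3} (λ c → value f a b c)))

-- On a fixed triple a share of `7/9` of all maps fails; by double counting some map fails on at
-- most this share of the triples.
good-map : ∀ {n m} (T : Fin m → Fin n × Fin n × Fin n) → (∀ t → Distinct (T t)) →
           ∃ λ f → 9 * count (λ t → clashes f (T t)) ≤ 7 * m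
good-map {n} {m} T distinct = sumᵛ-average-≤ n (7 * m) (λ f → 9 * cnt f) (≤-reflexive (begin
  sumᵛ n (λ f → 9 * cnt f)                                    ≡⟨ sym (*-distribˡ-sumᵛ n 9 cnt) ⟩
  9 * sumᵛ n cnt                                              ≡⟨ cong (9 *_) (sumᵛ-sum-comm n (λ t f → toNat (clashes f (T t)))) ⟩
  9 * sum (λ t → sumᵛ n (λ f → toNat (clashes f (T t))))      ≡⟨ *-distribˡ-sum 9 (λ t → sumᵛ n (λ f → toNat (clashes f (T t)))) ⟩
  sum (λ t → 9 * sumᵛ n (λ f → toNat (clashes f (T t))))      ≡⟨ sum-cong-≗ {m} (λ t → sum-clashes (T t) (distinct t)) ⟩
  sum {m} (λ _ → 7 * 3 ^ n)                                   ≡⟨ sum-const m (7 * 3 ^ n) ⟩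
  m * (7 * 3 ^ n)                                             ≡⟨ ring m (3 ^ n) ⟩
  3 ^ n * (7 * m)                                             ∎))
  where
  open ≡-Reasoning
  cnt : Vec (Fin 3) n → ℕ
  cnt f = count (λ t → clashes f (T t))
  ring : ∀ m p → m * (7 * p) ≡ p * (7 * m)
  ring = solve-∀

-- Abstract because the termination checker would otherwise unfold this
-- proof in the recursive call of hash-family.
abstract
  shrink : ∀ q m m′ → 9 * m′ ≤ 7 * m → m * 7 ^ suc q < 9 ^ suc q → m′ * 7 ^ q < 9 ^ q
  shrink q m m′ few lt = *-cancelˡ-< 9 (m′ * 7 ^ q) (9 ^ q) (≤-<-trans
    (≤-trans (≤-reflexive (sym (*-assoc 9 m′ (7 ^ q)))) (≤-trans (*-monoˡ-≤ (7 ^ q) few) (≤-reflexive (ring m (7 ^ q))))) lt)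
    where
    ring : ∀ m p → 7 * m * p ≡ m * (7 * p)
    ring = solve-∀

-- A greedy choice replaces the random one: each map leaves at most `7/9` of the remaining triples,
-- and after `q` maps fewer than one is left.
hash-family : ∀ {n} q {m} (T : Fin m → Fin n × Fin n × Fin n) → (∀ t → Distinct (T t)) → m * 7 ^ q < 9 ^ q →
  ∃ λ (fs : Fin q → Vec (Fin 3) n) → ∀ t → ∃ λ i → clashes (fs i) (T t) ≡ false
hash-family zero {m} T distinct lt =
  (λ ()) , λ t → contradiction (≤-pred (≤-<-trans (toℕ<n t) (subst (_< 1) (*-identityʳ m) lt))) n≮0
hash-family {n} (suc q) {m} T distinct lt = let f , few = good-map T distinct in extend f few
  where
  extend : ∀ f → 9 * count (λ t → clashes f (T t)) ≤ 7 * m →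
    ∃ λ (fs : Fin (suc q) → Vec (Fin 3) n) → ∀ t → ∃ λ i → clashes (fs i) (T t) ≡ false
  extend f few = f ∷ᶠ proj₁ rest , λ t → separate t (clashes f (T t)) refl
    where
    open Enumeration (enumerate (λ t → clashes f (T t)))
    rest = hash-family q (T ∘ enum) (distinct ∘ enum) (shrink q m (count (λ t → clashes f (T t))) few lt)
    separate : ∀ t b → clashes f (T t) ≡ b → ∃ λ i → clashes ((f ∷ᶠ proj₁ rest) i) (T t) ≡ false
    separate t false eq = zero , eq
    separate t true  eq with j , refl ← index t eq = let i , h = proj₂ rest j in suc i , h

-- If `p` holds nowhere the last index is returned; in the colouring this happens only for triples
-- with repeated points, whose colour is irrelevant.
first : ∀ {q} → (Fin (suc q) → Bool) → Fin (suc q)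
first {zero}  p = zero
first {suc q} p = if p zero then zero else suc (first (p ∘ suc))

first-cong : ∀ {q} {p p′ : Fin (suc q) → Bool} → p ≗ p′ → first p ≡ first p′
first-cong {zero}  h = refl
first-cong {suc q} h = cong₂ (λ b k → if b then zero else suc k) (h zero) (first-cong (h ∘ suc))

first-sound : ∀ {q} (p : Fin (suc q) → Bool) i → p i ≡ true → p (first p) ≡ true
first-sound {zero}  p zero pi = pi
first-sound {suc q} p i pi with p zero in p0
first-sound {suc q} p i       pi | true  = p0
first-sound {suc q} p zero    pi | false = contradiction (trans (sym p0) pi) λ ()
first-sound {suc q} p (suc i) pi | false = first-sound (p ∘ suc) i pi

==-comm : ∀ {n} (x y : Fin n) → (x == y) ≡ (y == x)
==-comm x y with x ≟ y
... | yes refl = sym (dec-true (y ≟ y) refl)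
... | no x≢y   = sym (dec-false (y ≟ x) (x≢y ∘ sym))

clash-sym₁₂ : ∀ a b c → clash a b c ≡ clash b a c
clash-sym₁₂ a b c = cong₂ _∨_ (==-comm a b) (∨-comm (b == c) (a == c))

clash-sym₂₃ : ∀ a b c → clash a b c ≡ clash a c b
clash-sym₂₃ a b c rewrite ==-comm b c = swap (a == b) (c == b) (a == c)
  where
  swap : ∀ p q r → p ∨ (q ∨ r) ≡ r ∨ (q ∨ p)
  swap p q r = trans (∨-comm p (q ∨ r)) (trans (cong (_∨ p) (∨-comm q r)) (∨-assoc r q p))

clash-false : ∀ a b c → clash a b c ≡ false → a ≢ b × b ≢ c × a ≢ c
clash-false a b c h with a ≟ b | b ≟ c | a ≟ c
... | no p | no p′ | no p″ = p , p′ , p″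

hash-colouring : ∀ {n q} → (Fin (suc q) → Vec (Fin 3) n) → Colouring n (suc q)
hash-colouring fs = record
  { col    = λ x y z → first (λ i → not (clashes (fs i) (x , y , z)))
  ; csym₁₂ = λ x y z → first-cong (λ i → cong not (clash-sym₁₂ (lookup (fs i) x) (lookup (fs i) y) (lookup (fs i) z)))
  ; csym₂₃ = λ x y z → first-cong (λ i → cong not (clash-sym₂₃ (lookup (fs i) x) (lookup (fs i) y) (lookup (fs i) z))) }

perfect-hash : ∀ {n} q → n * (n * n) * 7 ^ q < 9 ^ q →
  ∃ λ (fs : Fin q → Vec (Fin 3) n) → ∀ t → Distinct t → ∃ λ i → clashes (fs i) t ≡ false
perfect-hash {n} q lt =
  let fs , sep = hash-family q (triple ∘ enum) (λ t → does-true (distinct? (enum t)) (sound t))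
                   (≤-<-trans (*-monoˡ-≤ (7 ^ q) (injective⇒≤ injective)) lt)
  in fs , λ t d → find fs sep t (index (untriple t) (dec-true (distinct? (untriple t)) (subst Distinct (sym (triple-untriple t)) d)))
  where
  triple : Fin (n * (n * n)) → Fin n × Fin n × Fin n
  triple k = quotient (n * n) k , remQuot n (remainder {n} (n * n) k)
  untriple : Fin n × Fin n × Fin n → Fin (n * (n * n))
  untriple (x , y , z) = combine x (combine y z)
  triple-untriple : ∀ t → triple (untriple t) ≡ t
  triple-untriple (x , y , z) = cong₂ _,_ (quotient-combine x (combine y z))
    (trans (cong (remQuot n) (remainder-combine x (combine y z))) (remQuot-combine y z))
  distinct? : ∀ k → Dec (Distinct (triple k))
  distinct? k = let x , y , z = triple k in ¬? (x ≟ y) ×-dec ¬? (y ≟ z) ×-dec ¬? (x ≟ z)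
  open Enumeration (enumerate (λ k → does (distinct? k)))
  find : (fs : Fin q → Vec (Fin 3) n) → (∀ t → ∃ λ i → clashes (fs i) (triple (enum t)) ≡ false) →
    ∀ t → (∃ λ j → enum j ≡ untriple t) → ∃ λ i → clashes (fs i) t ≡ false
  find fs sep t (j , eq) = let i , h = sep j in
    i , subst (λ t → clashes (fs i) t ≡ false) (trans (cong triple eq) (triple-untriple t)) h

-- Every edge of a copy in colour `i` is rainbow under `fs i`, so `fs i` composed with the embedding
-- is a tripartition of `G`.
hash-avoids : ∀ G {q N} → ¬ Tripartite G → N * (N * N) * 7 ^ suc q < 9 ^ suc q → ¬ Arrows G (suc q) N
hash-avoids G {q} {N} ¬tri lt arr =
  let fs , sep = perfect-hash (suc q) lt
      i , φ , φ-inj , mono = arr (hash-colouring fs)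
  in ¬tri ((λ x → lookup (fs i) (φ x)) , λ x y z e →
       clash-false _ _ _ (rainbow fs sep i (φ x , φ y , φ z)
         (edge-≢₁₂ G e ∘ φ-inj , edge-≢₂₃ G e ∘ φ-inj , edge-≢₁₃ G e ∘ φ-inj) (mono x y z e)))
  where
  rainbow : (fs : Fin (suc q) → Vec (Fin 3) N) → (∀ t → Distinct t → ∃ λ i → clashes (fs i) t ≡ false) →
    ∀ i t → Distinct t → first (λ i → not (clashes (fs i) t)) ≡ i → clashes (fs i) t ≡ false
  rainbow fs sep i t d refl = not-injective (let j , h = sep t d in first-sound (λ i → not (clashes (fs i) t)) j (cong not h))

-- The exponent 9 comes from 2 ≤ (9/7)³.
exponential-lower-bound : ∀ G {q N} → ¬ Tripartite G → 1 ≤ q → Arrows G q N → 2 ^ (1 * q) ≤ N ^ 9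
exponential-lower-bound G {suc q} {N} ¬tri _ arr = ≮⇒≥ λ lt → hash-avoids G ¬tri (cube-cancel-< (begin-strict
  (N * (N * N) * 7 ^ suc q) ^ 3                  ≡⟨ ring N (7 ^ suc q) ⟩
  N ^ 9 * (7 ^ suc q) ^ 3                        ≡⟨ cong (N ^ 9 *_) (swap 7) ⟩
  N ^ 9 * 343 ^ suc q                            <⟨ *-monoˡ-< (343 ^ suc q) {{m^n≢0 343 (suc q)}} lt ⟩
  2 ^ (1 * suc q) * 343 ^ suc q                  ≡⟨ cong (λ e → 2 ^ e * 343 ^ suc q) (*-identityˡ (suc q)) ⟩
  2 ^ suc q * 343 ^ suc q                        ≡⟨ sym (^-distribʳ-* (suc q) 2 343) ⟩
  686 ^ suc q                                    ≤⟨ ^-monoˡ-≤ (suc q) (m≤m+n 686 43) ⟩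
  729 ^ suc q                                    ≡⟨ sym (swap 9) ⟩
  (9 ^ suc q) ^ 3                                ∎)) arr
  where
  open ≤-Reasoning
  ring : ∀ N p → N * (N * N) * p * (N * (N * N) * p * (N * (N * N) * p * 1)) ≡
    N * (N * (N * (N * (N * (N * (N * (N * (N * 1)))))))) * (p * (p * (p * 1)))
  ring = solve-∀
  swap : ∀ b → (b ^ suc q) ^ 3 ≡ (b ^ 3) ^ suc q
  swap b = trans (^-*-assoc b (suc q) 3) (trans (cong (b ^_) (*-comm (suc q) 3)) (sym (^-*-assoc b 3 (suc q))))
  cube-cancel-< : ∀ {x y} → x ^ 3 < y ^ 3 → x < y
  cube-cancel-< lt = ≰⇒> λ y≤x → <⇒≱ lt (^-monoˡ-≤ 3 y≤x)
  ^-distribʳ-* : ∀ n a b → (a * b) ^ n ≡ a ^ n * b ^ n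
  ^-distribʳ-* zero a b = refl
  ^-distribʳ-* (suc n) a b = trans (cong (a * b *_) (^-distribʳ-* n a b)) (ring′ a b (a ^ n) (b ^ n))
    where
    ring′ : ∀ a b p q → a * b * (p * q) ≡ a * p * (b * q)
    ring′ = solve-∀

-- Constructing members of 𝒰

inU-tabulate : ∀ {n} (p : Fin n → Bool) x → inU (tabulate p) x ≡ toNat (p x)
inU-tabulate p x with lookup (tabulate p) x | lookup∘tabulate p x
... | true  | eq = cong toNat eq
... | false | eq = cong toNat eq

meet-tabulate : ∀ {n} (p : Fin n → Bool) x y z → meet (tabulate p) x y z ≡ toNat (p x) + toNat (p y) + toNat (p z)
meet-tabulate p x y z = meet-≡ (tabulate p) (inU-tabulate p x) (inU-tabulate p y) (inU-tabulate p z)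

∈-tabulate⁺ : ∀ {n} (p : Fin n → Bool) {x} → p x ≡ true → x ∈ tabulate p
∈-tabulate⁺ p {x} px = lookup⇒[]= x (tabulate p) (trans (lookup∘tabulate p x) px)

∈-tabulate⁻ : ∀ {n} (p : Fin n → Bool) {x} → x ∈ tabulate p → p x ≡ true
∈-tabulate⁻ p {x} x∈ = trans (sym (lookup∘tabulate p x)) ([]=⇒lookup x∈)

∉-tabulate⁻ : ∀ {n} (p : Fin n → Bool) {x} → x ∉ tabulate p → p x ≡ false
∉-tabulate⁻ p {x} x∉ with p x in px
... | true  = contradiction (∈-tabulate⁺ p px) x∉
... | false = refl

ExactlyOne : ∀ {n} → Fin n → Fin n → Fin n → Fin n → Set
ExactlyOne s a b c = toNat (a == s) + toNat (b == s) + toNat (c == s) ≡ 1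

exactly-one₃ : ∀ (a b c : Fin 3) → a ≢ b × b ≢ c × a ≢ c → ExactlyOne zero a b c
exactly-one₃ = from-yes check
  where
  check : Dec (∀ (a b c : Fin 3) → a ≢ b × b ≢ c × a ≢ c → ExactlyOne zero a b c)
  check = all? λ a → all? λ b → all? λ c →
    (¬? (a ≟ b) ×-dec ¬? (b ≟ c) ×-dec ¬? (a ≟ c)) →-dec (toNat (a == zero) + toNat (b == zero) + toNat (c == zero) ≟ⁿ 1)

tripartite⇒transversal : ∀ {G} → Tripartite G → OneTransversal G
tripartite⇒transversal {G} (part , rainbow) = tabulate p , λ x y z e →
  trans (meet-tabulate p x y z) (exactly-one₃ (part x) (part y) (part z) (rainbow x y z e))
  where
  p : Fin (V G) → Bool
  p x = part x == zero

-- `red` asks for positive ranks and no constructor leads from rank 0 to rank 1, but one part of a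
-- tripartition is a transversal.
positive-rank : ∀ {G} → InUAny G → ∃ λ i → InU (suc i) G
positive-rank {G} (zero  , tri t) = zero , InU.trans (tripartite⇒transversal {G} t)
positive-rank     (suc i , u)     = i , u

raise : ∀ {i G} k → InU (suc i) G → InU (suc (k + i)) G
raise zero    u = u
raise (suc k) u = up (raise k u)

reducible⇒InUAny : ∀ {G H F} → Reducible G H F → InUAny H → InUAny F → InUAny G
reducible⇒InUAny {G} {H} {F} r H∈ F∈ =
  let a , h = positive-rank H∈
      b , f = positive-rank F∈
  in suc (suc (b + a)) , red {G = G} {H} {F} r (raise b h) (up (subst (λ n → InU (suc n) F) (+-comm a b) (raise a f)))

-- `H` is realised on vertices of `G`, with `u` standing for the collapsed vertex: `σ` embeds them
-- and `ρ` sends the collapsed set to `u`. Maps out of `G` then restrict to `H` along `σ` and to `F`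
-- along `τ`.
record Reduction (G : 3Graph) (p : Fin (V G) → Bool) (u : Fin (V G)) : Set where
  ρ : Fin (V G) → Fin (V G)
  ρ x = if p x then u else x
  field
    H F       : 3Graph
    reducible : Reducible G H F
    H<G       : V H < V G
    F<G       : V F < V G
    σ         : Fin (V H) → Fin (V G)
    σ-inj     : Injective _≡_ _≡_ σ
    σ-edge    : ∀ a b c → Edge H a b c → ∃ λ x → ∃ λ y → ∃ λ z → Edge G x y z ×
                  toNat (p x) + toNat (p y) + toNat (p z) ≢ 3 × σ a ≡ ρ x × σ b ≡ ρ y × σ c ≡ ρ z
    τ         : Fin (V F) → Fin (V G)
    τ-inj     : Injective _≡_ _≡_ τ
    τ-edge    : ∀ a b c → Edge F a b c → Edge G (τ a) (τ b) (τ c)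

-- `u` and `u′` witness that the set has two elements, `o` that it is proper.
reduce : ∀ G (p : Fin (V G) → Bool) {u u′ o} → u ≢ u′ → p u ≡ true → p u′ ≡ true → p o ≡ false →
  (∀ x y z → Edge G x y z → toNat (p x) + toNat (p y) + toNat (p z) ≢ 2) → Reduction G p u
reduce G p {u} {u′} {o} u≢u′ pu pu′ po no2 = record
  { H = H ; F = F
  ; reducible = U , (2≤U , U<V , no2′) , collapse , induced
  ; H<G = injective-missing-< W.injective (u′ , λ a eq → false≢true (trans (sym Wu′) (trans (cong W (sym eq)) (W.sound a))))
  ; F<G = injective-missing-< P.injective (o , λ a eq → false≢true (trans (sym po) (trans (cong p (sym eq)) (P.sound a))))
  ; σ = W.enum ; σ-inj = W.injective
  ; σ-edge = λ a b c e → let x , y , z , e′ , ≢3 , ex , ey , ez = edge-witness a b c e in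
      x , y , z , e′ , ≢3 , back ex , back ey , back ez
  ; τ = P.enum ; τ-inj = P.injective ; τ-edge = λ a b c e → e }
  where
  false≢true : ¬ false ≡ true
  false≢true ()
  U = tabulate p
  2≤U : 2 ≤ ∣ U ∣
  2≤U = subst (_< ∣ U ∣) (∣⁅x⁆∣≡1 u) (p⊂q⇒∣p∣<∣q∣
    ((λ x∈ → subst (_∈ U) (sym (x∈⁅y⁆⇒x≡y u x∈)) (∈-tabulate⁺ p pu)) , u′ , ∈-tabulate⁺ p pu′ , λ u′∈ → u≢u′ (sym (x∈⁅y⁆⇒x≡y u u′∈))))
  U<V : ∣ U ∣ < V G
  U<V = subst (∣ U ∣ <_) (∣⊤∣≡n (V G)) (p⊂q⇒∣p∣<∣q∣ (⊆⊤ , o , ∈⊤ , λ o∈ → false≢true (trans (sym po) (∈-tabulate⁻ p o∈))))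
  no2′ : ∀ x y z → Edge G x y z → meet U x y z ≢ 2
  no2′ x y z e eq = no2 x y z e (trans (sym (meet-tabulate p x y z)) eq)
  -- The vertex set of `H`: everything outside the collapsed set, and its representative.
  W : Fin (V G) → Bool
  W x = not (p x) ∨ (x == u)
  module W = Enumeration (enumerate W)
  module P = Enumeration (enumerate p)
  Wu′ : W u′ ≡ false
  Wu′ = cong₂ (λ a b → not a ∨ b) pu′ (dec-false (u′ ≟ u) (u≢u′ ∘ sym))
  ρ : Fin (V G) → Fin (V G)
  ρ x = if p x then u else x
  W-ρ : ∀ x → W (ρ x) ≡ true
  W-ρ x with p x in px
  ... | true  = cong₂ (λ a b → not a ∨ b) pu (dec-true (u ≟ u) refl)
  ... | false = cong (λ a → not a ∨ (x == u)) px
  π : Fin (V G) → Fin (count W)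
  π x = proj₁ (W.index (ρ x) (W-ρ x))
  σπ : ∀ x → W.enum (π x) ≡ ρ x
  σπ x = proj₂ (W.index (ρ x) (W-ρ x))
  back : ∀ {x a} → π x ≡ a → W.enum a ≡ ρ x
  back {x} refl = σπ x
  ρ-∈ : ∀ {x} → p x ≡ true → ρ x ≡ u
  ρ-∈ {x} px rewrite px = refl
  ρ-∉ : ∀ {x} → p x ≡ false → ρ x ≡ x
  ρ-∉ {x} px rewrite px = refl
  ρ-fixed : ∀ x → W x ≡ true → ρ x ≡ x
  ρ-fixed x Wx with p x
  ... | true  = sym (==⇒≡ Wx)
  ... | false = refl
  π-≡ : ∀ {x y} → π x ≡ π y → ρ x ≡ ρ y
  π-≡ {x} {y} eq = trans (sym (σπ x)) (trans (cong W.enum eq) (σπ y))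
  EdgeH : Fin (count W) → Fin (count W) → Fin (count W) → Set
  EdgeH a b c = ∃ λ x → ∃ λ y → ∃ λ z → Edge G x y z × toNat (p x) + toNat (p y) + toNat (p z) ≢ 3 × π x ≡ a × π y ≡ b × π z ≡ c
  edgeH? : ∀ a b c → Dec (EdgeH a b c)
  edgeH? a b c = any? λ x → any? λ y → any? λ z →
    (E G x y z ≟ᵇ true) ×-dec ¬? (toNat (p x) + toNat (p y) + toNat (p z) ≟ⁿ 3) ×-dec (π x ≟ a) ×-dec (π y ≟ b) ×-dec (π z ≟ c)
  swap₁₂ : ∀ a b c → EdgeH a b c → EdgeH b a c
  swap₁₂ a b c (x , y , z , e , ≢3 , ex , ey , ez) = y , x , z , trans (sym₁₂ G y x z) e ,
    (λ eq → ≢3 (trans (cong (_+ toNat (p z)) (+-comm (toNat (p x)) _)) eq)) , ey , ex , ez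
  swap₂₃ : ∀ a b c → EdgeH a b c → EdgeH a c b
  swap₂₃ a b c (x , y , z , e , ≢3 , ex , ey , ez) = x , z , y , trans (sym₂₃ G x z y) e ,
    (λ eq → ≢3 (trans (+-assoc (toNat (p x)) _ _) (trans (cong (toNat (p x) +_) (+-comm (toNat (p y)) _)) (trans (sym (+-assoc (toNat (p x)) _ _)) eq)))) , ex , ez , ey
  -- Collapsibility enters here: two distinct vertices with the same image both lie in the set, so
  -- the edge would meet it in two or three vertices.
  no-loop : ∀ a c → ¬ EdgeH a a c
  no-loop a c (x , y , z , e , ≢3 , ex , ey , _) = cases (p x) (p y) (p z) refl refl refl
    where
    ρx≡ρy : ρ x ≡ ρ y
    ρx≡ρy = π-≡ (trans ex (sym ey))
    x≢y : x ≢ y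
    x≢y = edge-≢₁₂ G e
    sum-≡ : ∀ {a b c} → p x ≡ a → p y ≡ b → p z ≡ c → toNat (p x) + toNat (p y) + toNat (p z) ≡ toNat a + toNat b + toNat c
    sum-≡ refl refl refl = refl
    cases : ∀ a b c → p x ≡ a → p y ≡ b → p z ≡ c → ⊥
    cases true  true  true  px py pz = ≢3 (sum-≡ px py pz)
    cases true  true  false px py pz = no2 x y z e (sum-≡ px py pz)
    cases true  false _     px py _  = false≢true (trans (sym py) (trans (cong p (trans (sym (ρ-∉ py)) (trans (sym ρx≡ρy) (ρ-∈ px)))) pu))
    cases false true  _     px py _  = false≢true (trans (sym px) (trans (cong p (trans (sym (ρ-∉ px)) (trans ρx≡ρy (ρ-∈ py)))) pu))
    cases false false _     px py _  = x≢y (trans (sym (ρ-∉ px)) (trans ρx≡ρy (ρ-∉ py)))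
  H F : 3Graph
  H = record
    { V = count W
    ; E = λ a b c → does (edgeH? a b c)
    ; sym₁₂ = λ a b c → does-⇔ (mk⇔ (swap₁₂ a b c) (swap₁₂ b a c)) (edgeH? a b c) (edgeH? b a c)
    ; sym₂₃ = λ a b c → does-⇔ (mk⇔ (swap₂₃ a b c) (swap₂₃ a c b)) (edgeH? a b c) (edgeH? a c b)
    ; loopless = λ a c → dec-false (edgeH? a a c) (no-loop a c) }
  F = record
    { V = count p
    ; E = λ a b c → E G (P.enum a) (P.enum b) (P.enum c)
    ; sym₁₂ = λ a b c → sym₁₂ G _ _ _ ; sym₂₃ = λ a b c → sym₂₃ G _ _ _ ; loopless = λ a c → loopless G _ _ }
  edge-witness : ∀ a b c → Edge H a b c → EdgeH a b c
  edge-witness a b c = does-true (edgeH? a b c)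
  collapse : IsCollapse G U H
  collapse = π
    , (λ a → W.enum a , λ { refl → W.injective (trans (σπ (W.enum a)) (ρ-fixed (W.enum a) (W.sound a))) })
    , (λ x y x∉ y∉ eq → trans (sym (ρ-∉ (∉-tabulate⁻ p x∉))) (trans (π-≡ eq) (ρ-∉ (∉-tabulate⁻ p y∉))))
    , (λ v v′ v∈ v′∈ → W.injective (trans (σπ v) (trans (ρ-∈ (∈-tabulate⁻ p v∈)) (sym (trans (σπ v′) (ρ-∈ (∈-tabulate⁻ p v′∈)))))))
    , (λ x v x∉ v∈ eq → x∉ (subst (_∈ U) (sym (trans (sym (ρ-∉ (∉-tabulate⁻ p x∉))) (trans (π-≡ eq) (ρ-∈ (∈-tabulate⁻ p v∈))))) (∈-tabulate⁺ p pu)))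
    , (λ a b c e → let x , y , z , e′ , ≢3 , eqs = edge-witness a b c e in
         x , y , z , e′ , (λ eq → ≢3 (trans (sym (meet-tabulate p x y z)) eq)) , eqs)
    , (λ x y z e ≢3 → dec-true (edgeH? (π x) (π y) (π z)) (x , y , z , e , (λ eq → ≢3 (trans (meet-tabulate p x y z) eq)) , refl , refl , refl))
  induced : IsInduced G U F
  induced = P.enum , P.injective , (λ j → ∈-tabulate⁺ p (P.sound j)) , (λ x x∈ → P.index x (∈-tabulate⁻ p x∈)) , λ a b c → refl

argmax : ∀ {n} → Fin n → (f : Fin n → ℕ) → ∃ λ o → ∀ x → f x ≤ f o
argmax {suc zero}    _ f = zero , λ { zero → ≤-refl }
argmax {suc (suc n)} _ f with argmax zero (f ∘ suc)
... | o , top with f zero ≤? f (suc o)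
...   | yes le = suc o , λ { zero → le ; (suc x) → top x }
...   | no  gt = zero , λ { zero → ≤-refl ; (suc x) → ≤-trans (top x) (<⇒≤ (≰⇒> gt)) }

-- The pattern of the two new colours in the square: a lone vertex strictly before the common layer
-- of the other two.
LayeredTriple : ℕ → ℕ → ℕ → Set
LayeredTriple a b c = (a < b × b ≡ c) ⊎ (b < a × a ≡ c) ⊎ (c < a × a ≡ b)

Layered : (G : 3Graph) → (Fin (V G) → ℕ) → Set
Layered G key = ∀ x y z → Edge G x y z → LayeredTriple (key x) (key y) (key z)

below : ℕ → ℕ → Bool
below M a = does (a <? M)

-- The layer of the equal pair decides: at `M` only the lone vertex is below, under `M` all three
-- are.
layered-sum : ∀ M a b c → a ≤ M → b ≤ M → c ≤ M → LayeredTriple a b c →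
  toNat (below M a) + toNat (below M b) + toNat (below M c) ≡ 1 ⊎ (below M a ≡ true × below M b ≡ true × below M c ≡ true)
layered-sum M a b c a≤ b≤ c≤ layers = cases layers
  where
  is : ∀ {k} → k < M → below M k ≡ true
  is {k} lt = dec-true (k <? M) lt
  isn't : ∀ {k} → ¬ k < M → below M k ≡ false
  isn't {k} ge = dec-false (k <? M) ge
  cases : LayeredTriple a b c → _
  cases (inj₁ (a<b , refl)) with b <? M
  ... | yes b<M = inj₂ (is (<-trans a<b b<M) , is b<M , is b<M)
  ... | no  b≮M = inj₁ (cong₃ (λ p q r → toNat p + toNat q + toNat r) (is (<-≤-trans a<b b≤)) (isn't b≮M) (isn't b≮M))
  cases (inj₂ (inj₁ (b<a , refl))) with a <? M
  ... | yes a<M = inj₂ (is a<M , is (<-trans b<a a<M) , is a<M)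
  ... | no  a≮M = inj₁ (cong₃ (λ p q r → toNat p + toNat q + toNat r) (isn't a≮M) (is (<-≤-trans b<a a≤)) (isn't a≮M))
  cases (inj₂ (inj₂ (c<a , refl))) with a <? M
  ... | yes a<M = inj₂ (is a<M , is a<M , is (<-trans c<a a<M))
  ... | no  a≮M = inj₁ (cong₃ (λ p q r → toNat p + toNat q + toNat r) (isn't a≮M) (isn't a≮M) (is (<-≤-trans c<a a≤)))

-- The vertices below the top layer form a collapsible set, and collapsing
-- it leaves a single transversal vertex.
layered⇒InUAny : ∀ n G → V G ≤ n → (key : Fin (V G) → ℕ) → Layered G key → InUAny G
layered⇒InUAny n G le key layered with any? {V G} (λ _ → yes tt)
... | no ¬x = 1 , InU.trans (tabulate (const false) , λ x → contradiction (x , tt) ¬x)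
layered⇒InUAny zero G le key layered | yes (x₀ , _) = contradiction (<-≤-trans (toℕ<n x₀) le) n≮0
layered⇒InUAny (suc n) G le key layered | yes (x₀ , _)
  with any? (λ u → any? (λ u′ → ¬? (u ≟ u′) ×-dec (p u ≟ᵇ true) ×-dec (p u′ ≟ᵇ true)))
  where
  p : Fin (V G) → Bool
  p x = below (key (proj₁ (argmax x₀ key))) (key x)
-- With at most one vertex below the top layer no edge lies entirely below it, so every edge has
-- exactly one vertex there.
... | no ¬two = 1 , InU.trans (tabulate p , λ x y z e → trans (meet-tabulate p x y z) (one x y z e))
  where
  o = proj₁ (argmax x₀ key)
  top = proj₂ (argmax x₀ key)
  p : Fin (V G) → Bool
  p x = below (key o) (key x)
  one : ∀ x y z → Edge G x y z → toNat (p x) + toNat (p y) + toNat (p z) ≡ 1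
  one x y z e with layered-sum (key o) (key x) (key y) (key z) (top x) (top y) (top z) (layered x y z e)
  ... | inj₁ eq = eq
  ... | inj₂ (px , py , _) = contradiction (x , y , edge-≢₁₂ G e , px , py) ¬two
... | yes (u , u′ , u≢u′ , pu , pu′) = reducible⇒InUAny {G} {H} {F} reducible H∈U F∈U
  where
  o = proj₁ (argmax x₀ key)
  top = proj₂ (argmax x₀ key)
  p : Fin (V G) → Bool
  p x = below (key o) (key x)
  layers : ∀ x y z → Edge G x y z →
    toNat (p x) + toNat (p y) + toNat (p z) ≡ 1 ⊎ (p x ≡ true × p y ≡ true × p z ≡ true)
  layers x y z e = layered-sum (key o) (key x) (key y) (key z) (top x) (top y) (top z) (layered x y z e)
  three : ∀ {x y z} → p x ≡ true × p y ≡ true × p z ≡ true → toNat (p x) + toNat (p y) + toNat (p z) ≡ 3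
  three (px , py , pz) = cong₃ (λ p q r → toNat p + toNat q + toNat r) px py pz
  no2 : ∀ x y z → Edge G x y z → toNat (p x) + toNat (p y) + toNat (p z) ≢ 2
  no2 x y z e eq with layers x y z e
  ... | inj₁ eq1 = contradiction (trans (sym eq1) eq) λ ()
  ... | inj₂ all = contradiction (trans (sym (three all)) eq) λ ()
  open Reduction (reduce G p {u} {u′} {o} u≢u′ pu pu′ (dec-false (key o <? key o) (<-irrefl refl)) no2)
  p-ρ : ∀ x → p (ρ x) ≡ p x
  p-ρ x with p x in px
  ... | true  = pu
  ... | false = px
  H∈U : InUAny H
  H∈U = 1 , InU.trans (tabulate (p ∘ σ) , λ a b c e →
    let x , y , z , e′ , ≢3 , ea , eb , ec = σ-edge a b c e in
    trans (meet-tabulate (p ∘ σ) a b c)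
      (trans (cong₃ (λ p q r → toNat p + toNat q + toNat r)
               (trans (cong p ea) (p-ρ x)) (trans (cong p eb) (p-ρ y)) (trans (cong p ec) (p-ρ z)))
        (one (layers x y z e′) ≢3)))
    where
    one : ∀ {x y z} → toNat (p x) + toNat (p y) + toNat (p z) ≡ 1 ⊎ (p x ≡ true × p y ≡ true × p z ≡ true) →
      toNat (p x) + toNat (p y) + toNat (p z) ≢ 3 → toNat (p x) + toNat (p y) + toNat (p z) ≡ 1
    one (inj₁ eq) _ = eq
    one {x} {y} {z} (inj₂ all) ≢3 = contradiction (three {x} {y} {z} all) ≢3
  F∈U : InUAny F
  F∈U = layered⇒InUAny n F (≤-pred (≤-trans F<G le)) (key ∘ τ) (λ a b c e → layered (τ a) (τ b) (τ c) (τ-edge a b c e))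

-- Lower bound outside 𝒰

Good : ℕ → ℕ → Set
Good N q = Σ (Colouring N q) λ c → ∀ i G → MonoCopy G c i → InUAny G

data Shape {N} (x y z : Fin N) : Set where
  same    : x ≡ y → y ≡ z → Shape x y z
  single₁ : x ≢ y → y ≡ z → Shape x y z
  single₂ : y ≢ x → x ≡ z → Shape x y z
  single₃ : z ≢ x → x ≡ y → Shape x y z
  rainbow : x ≢ y → y ≢ z → x ≢ z → Shape x y z

shape : ∀ {N} (x y z : Fin N) → Shape x y z
shape x y z with x ≟ y | y ≟ z | x ≟ z
... | yes p | yes q | _     = same p q
... | yes p | no ¬q | _     = single₃ (λ z≡x → ¬q (trans (sym p) (sym z≡x))) p
... | no ¬p | yes q | _     = single₁ ¬p q
... | no ¬p | no ¬q | yes r = single₂ (¬p ∘ sym) r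
... | no ¬p | no ¬q | no ¬r = rainbow ¬p ¬q ¬r

swap₁₂ : ∀ {N} {x y z : Fin N} → Shape x y z → Shape y x z
swap₁₂ (same p q)      = same (sym p) (trans p q)
swap₁₂ (single₁ p q)   = single₂ p q
swap₁₂ (single₂ p q)   = single₁ p q
swap₁₂ (single₃ p q)   = single₃ (λ z≡y → p (trans z≡y (sym q))) (sym q)
swap₁₂ (rainbow p q r) = rainbow (p ∘ sym) r q

swap₂₃ : ∀ {N} {x y z : Fin N} → Shape x y z → Shape x z y
swap₂₃ (same p q)      = same (trans p q) (sym q)
swap₂₃ (single₁ p q)   = single₁ (λ x≡z → p (trans x≡z (sym q))) (sym q)
swap₂₃ (single₂ p q)   = single₃ p q
swap₂₃ (single₃ p q)   = single₂ p q
swap₂₃ (rainbow p q r) = rainbow r (q ∘ sym) p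

module Square {N q : ℕ} (c : Colouring N q) where

  outer inner : Fin (N * N) → Fin N
  outer = quotient N
  inner = remainder {N} N

  -- `s` is the fibre of the lone point and `t` the fibre of the pair.
  new : Fin N → Fin N → Fin (2 + q)
  new s t = if does (s <ᶠ? t) then zero else suc zero

  old : Fin q → Fin (2 + q)
  old i = suc (suc i)

  paint : ∀ P Q R → Shape (outer P) (outer Q) (outer R) → Fin (2 + q)
  paint P Q R (same _ _)      = old (col c (inner P) (inner Q) (inner R))
  paint P Q R (single₁ _ _)   = new (outer P) (outer Q)
  paint P Q R (single₂ _ _)   = new (outer Q) (outer P)
  paint P Q R (single₃ _ _)   = new (outer R) (outer P)
  paint P Q R (rainbow _ _ _) = old (col c (outer P) (outer Q) (outer R))

  -- Symmetry of the square is easy for a permuted `Shape`; independence of the evidence carries it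
  -- over to the one that `shape` computes.
  paint-unique : ∀ P Q R (s t : Shape (outer P) (outer Q) (outer R)) → paint P Q R s ≡ paint P Q R t
  paint-unique P Q R (same _ _)      (same _ _)      = refl
  paint-unique P Q R (single₁ _ _)   (single₁ _ _)   = refl
  paint-unique P Q R (single₂ _ _)   (single₂ _ _)   = refl
  paint-unique P Q R (single₃ _ _)   (single₃ _ _)   = refl
  paint-unique P Q R (rainbow _ _ _) (rainbow _ _ _) = refl
  paint-unique P Q R (same p q)      (single₁ p′ _)  = contradiction p p′
  paint-unique P Q R (same p q)      (single₂ p′ _)  = contradiction (sym p) p′
  paint-unique P Q R (same p q)      (single₃ p′ _)  = contradiction (sym (trans p q)) p′
  paint-unique P Q R (same p q)      (rainbow p′ _ _) = contradiction p p′
  paint-unique P Q R (single₁ p q)   (same p′ _)     = contradiction p′ p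
  paint-unique P Q R (single₁ p q)   (single₂ _ r)   = contradiction (trans r (sym q)) p
  paint-unique P Q R (single₁ p q)   (single₃ _ r)   = contradiction r p
  paint-unique P Q R (single₁ p q)   (rainbow _ r _) = contradiction q r
  paint-unique P Q R (single₂ p q)   (same r _)      = contradiction (sym r) p
  paint-unique P Q R (single₂ p q)   (single₁ _ r)   = contradiction (trans r (sym q)) p
  paint-unique P Q R (single₂ p q)   (single₃ r _)   = contradiction (sym q) r
  paint-unique P Q R (single₂ p q)   (rainbow _ _ r) = contradiction q r
  paint-unique P Q R (single₃ p q)   (same r r′)     = contradiction (sym (trans r r′)) p
  paint-unique P Q R (single₃ p q)   (single₁ r _)   = contradiction q r
  paint-unique P Q R (single₃ p q)   (single₂ r _)   = contradiction (sym q) r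
  paint-unique P Q R (single₃ p q)   (rainbow r _ _) = contradiction q r
  paint-unique P Q R (rainbow p q r) (same s _)      = contradiction s p
  paint-unique P Q R (rainbow p q r) (single₁ _ s)   = contradiction s q
  paint-unique P Q R (rainbow p q r) (single₂ _ s)   = contradiction s r
  paint-unique P Q R (rainbow p q r) (single₃ _ s)   = contradiction s p

  paint-swap₁₂ : ∀ P Q R s → paint P Q R s ≡ paint Q P R (swap₁₂ s)
  paint-swap₁₂ P Q R (same _ _)      = cong old (csym₁₂ c _ _ _)
  paint-swap₁₂ P Q R (single₁ _ _)   = refl
  paint-swap₁₂ P Q R (single₂ _ _)   = refl
  paint-swap₁₂ P Q R (single₃ _ q)   = cong (new (outer R)) q
  paint-swap₁₂ P Q R (rainbow _ _ _) = cong old (csym₁₂ c _ _ _)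

  paint-swap₂₃ : ∀ P Q R s → paint P Q R s ≡ paint P R Q (swap₂₃ s)
  paint-swap₂₃ P Q R (same _ _)      = cong old (csym₂₃ c _ _ _)
  paint-swap₂₃ P Q R (single₁ _ q)   = cong (new (outer P)) q
  paint-swap₂₃ P Q R (single₂ _ _)   = refl
  paint-swap₂₃ P Q R (single₃ _ _)   = refl
  paint-swap₂₃ P Q R (rainbow _ _ _) = cong old (csym₂₃ c _ _ _)

  square : Colouring (N * N) (2 + q)
  square = record
    { col    = λ P Q R → paint P Q R (shape (outer P) (outer Q) (outer R))
    ; csym₁₂ = λ P Q R → let s = shape (outer P) (outer Q) (outer R) in
        trans (paint-swap₁₂ P Q R s) (paint-unique Q P R (swap₁₂ s) (shape (outer Q) (outer P) (outer R)))
    ; csym₂₃ = λ P Q R → let s = shape (outer P) (outer Q) (outer R) in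
        trans (paint-swap₂₃ P Q R s) (paint-unique P R Q (swap₂₃ s) (shape (outer P) (outer R) (outer Q))) }

  Fibred : Fin q → Fin (N * N) → Fin (N * N) → Fin (N * N) → Set
  Fibred i P Q R =
    (outer P ≡ outer Q × outer Q ≡ outer R × col c (inner P) (inner Q) (inner R) ≡ i) ⊎
    ((outer P ≢ outer Q × outer Q ≢ outer R × outer P ≢ outer R) × col c (outer P) (outer Q) (outer R) ≡ i)

  new≢old : ∀ s t i → new s t ≢ old i
  new≢old s t i eq with does (s <ᶠ? t)
  new≢old s t i () | true
  new≢old s t i () | false

  old-injective : ∀ {i j} → old i ≡ old j → i ≡ j
  old-injective refl = refl

  square-old : ∀ P Q R i → col square P Q R ≡ old i → Fibred i P Q R
  square-old P Q R i eq with shape (outer P) (outer Q) (outer R)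
  ... | same p q      = inj₁ (p , q , old-injective eq)
  ... | single₁ _ _   = contradiction eq (new≢old (outer P) (outer Q) i)
  ... | single₂ _ _   = contradiction eq (new≢old (outer Q) (outer P) i)
  ... | single₃ _ _   = contradiction eq (new≢old (outer R) (outer P) i)
  ... | rainbow p q r = inj₂ ((p , q , r) , old-injective eq)

  new-zero : ∀ s t → new s t ≡ zero → s <ᶠ t
  new-zero s t eq = decidable-stable (s <ᶠ? t) λ ge →
    contradiction (trans (sym eq) (cong (if_then zero else suc zero) (dec-false (s <ᶠ? t) ge))) λ ()

  new-one : ∀ s t → s ≢ t → new s t ≡ suc zero → t <ᶠ s
  new-one s t s≢t eq = ≤∧≢⇒< (≮⇒≥ λ lt →
    contradiction (trans (sym eq) (cong (if_then zero else suc zero) (dec-true (s <ᶠ? t) lt))) λ ()) (s≢t ∘ sym ∘ toℕ-injective)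

  -- An abstract `key` covers both new colours: the fibres are ordered by `toℕ` for one and in
  -- reverse for the other, so that the lone point always comes first.
  layered : ∀ (key : Fin N → ℕ) k → (∀ i → old i ≢ k) → (∀ s t → s ≢ t → new s t ≡ k → key s < key t) →
    ∀ P Q R → col square P Q R ≡ k → LayeredTriple (key (outer P)) (key (outer Q)) (key (outer R))
  layered key k notold order P Q R eq with shape (outer P) (outer Q) (outer R)
  ... | same _ _      = contradiction eq (notold _)
  ... | single₁ p q   = inj₁ (order (outer P) (outer Q) p eq , cong key q)
  ... | single₂ p q   = inj₂ (inj₁ (order (outer Q) (outer P) p eq , cong key q))
  ... | single₃ p q   = inj₂ (inj₂ (order (outer R) (outer P) p eq , cong key q))
  ... | rainbow _ _ _ = contradiction eq (notold _)

  -- Collapse the fibres until a copy in one factor remains.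
  fibred⇒InUAny : ∀ i → (∀ G → MonoCopy G c i → InUAny G) → ∀ n G → V G ≤ n →
    (φ : Fin (V G) → Fin (N * N)) → Injective _≡_ _≡_ φ →
    (∀ x y z → Edge G x y z → Fibred i (φ x) (φ y) (φ z)) → InUAny G
  fibred⇒InUAny i good n G le φ φ-inj fibred
    with any? (λ u → any? (λ u′ → ¬? (u ≟ u′) ×-dec (outer (φ u) ≟ outer (φ u′))))
  -- No two vertices share a fibre, so the outer coordinates embed `G`.
  ... | no ¬two = good G (outer ∘ φ , injective , mono)
    where
    injective : Injective _≡_ _≡_ (outer ∘ φ)
    injective {x} {y} eq = decidable-stable (x ≟ y) λ x≢y → ¬two (x , y , x≢y , eq)
    mono : ∀ x y z → Edge G x y z → col c (outer (φ x)) (outer (φ y)) (outer (φ z)) ≡ i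
    mono x y z e with fibred x y z e
    ... | inj₁ (p , _) = contradiction (injective p) (edge-≢₁₂ G e)
    ... | inj₂ (_ , q) = q
  ... | yes (u , u′ , u≢u′ , same-fibre) with any? (λ o → ¬? (outer (φ o) ≟ outer (φ u)))
  -- One fibre contains all vertices, so the inner coordinates embed `G`.
  ...   | no ¬out = good G (inner ∘ φ , (λ {x} {y} → injective x y) , mono)
    where
    const-outer : ∀ x → outer (φ x) ≡ outer (φ u)
    const-outer x = decidable-stable (outer (φ x) ≟ outer (φ u)) λ ne → ¬out (x , ne)
    injective : ∀ x y → inner (φ x) ≡ inner (φ y) → x ≡ y
    injective x y eq = φ-inj (trans (sym (combine-remQuot {N} N (φ x)))
      (trans (cong₂ combine (trans (const-outer x) (sym (const-outer y))) eq) (combine-remQuot {N} N (φ y))))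
    mono : ∀ x y z → Edge G x y z → col c (inner (φ x)) (inner (φ y)) (inner (φ z)) ≡ i
    mono x y z e with fibred x y z e
    ... | inj₁ (_ , _ , q) = q
    ... | inj₂ ((ne , _) , _) = contradiction (trans (const-outer x) (sym (const-outer y))) ne
  fibred⇒InUAny i good zero G le φ φ-inj fibred | yes (u , _) | yes _ = contradiction (<-≤-trans (toℕ<n u) le) n≮0
  fibred⇒InUAny i good (suc n) G le φ φ-inj fibred | yes (u , u′ , u≢u′ , same-fibre) | yes (o , out) =
    reducible⇒InUAny {G} {H} {F} reducible
      (fibred⇒InUAny i good n H (≤-pred (≤-trans H<G le)) (φ ∘ σ) (σ-inj ∘ φ-inj) H-fibred)
      (fibred⇒InUAny i good n F (≤-pred (≤-trans F<G le)) (φ ∘ τ) (τ-inj ∘ φ-inj)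
        (λ a b d e → fibred (τ a) (τ b) (τ d) (τ-edge a b d e)))
    where
    p : Fin (V G) → Bool
    p x = outer (φ x) == outer (φ u)
    p-cong : ∀ {x y} → outer (φ x) ≡ outer (φ y) → p x ≡ p y
    p-cong eq = cong (_== outer (φ u)) eq
    not-both : ∀ {x y} → outer (φ x) ≢ outer (φ y) → p x ≡ true → p y ≡ true → ⊥
    not-both ne px py = ne (trans (==⇒≡ px) (sym (==⇒≡ py)))
    -- An edge inside a fibre meets the fibre of `u` in three vertices or none, an edge across three
    -- fibres in at most one.
    no2 : ∀ x y z → Edge G x y z → toNat (p x) + toNat (p y) + toNat (p z) ≢ 2
    no2 x y z e eq with fibred x y z e
    ... | inj₁ (xy , yz , _) = triple (p z) (subst₂ (λ a b → toNat a + toNat b + toNat (p z) ≡ 2) (p-cong (trans xy yz)) (p-cong yz) eq)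
      where
      triple : ∀ b → toNat b + toNat b + toNat b ≢ 2
      triple true  ()
      triple false ()
    ... | inj₂ ((xy , yz , xz) , _) = rainbow-sum (p x) (p y) (p z) (not-both xy) (not-both yz) (not-both xz) eq
      where
      rainbow-sum : ∀ a b d → (a ≡ true → b ≡ true → ⊥) → (b ≡ true → d ≡ true → ⊥) → (a ≡ true → d ≡ true → ⊥) →
        toNat a + toNat b + toNat d ≢ 2
      rainbow-sum true true d f _ _ _ = f refl refl
      rainbow-sum true false true _ _ f _ = f refl refl
      rainbow-sum false true true _ f _ _ = f refl refl
      rainbow-sum true false false _ _ _ ()
      rainbow-sum false true false _ _ _ ()
      rainbow-sum false false true _ _ _ ()
      rainbow-sum false false false _ _ _ ()
    open Reduction (reduce G p {u} {u′} {o} u≢u′ (dec-true (outer (φ u) ≟ outer (φ u)) refl)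
      (dec-true (outer (φ u′) ≟ outer (φ u)) (sym same-fibre)) (dec-false (outer (φ o) ≟ outer (φ u)) out) no2)
    outer-ρ : ∀ x → outer (φ (ρ x)) ≡ outer (φ x)
    outer-ρ x with p x in px
    ... | true  = sym (==⇒≡ px)
    ... | false = refl
    fix : ∀ {x} → p x ≡ false → ρ x ≡ x
    fix {x} px rewrite px = refl
    -- `ρ` moves a vertex only within its fibre, so an edge across three fibres keeps its outer
    -- coordinates; an edge inside a fibre other than the collapsed one is not moved.
    ρ-fibred : ∀ x y z → Edge G x y z → toNat (p x) + toNat (p y) + toNat (p z) ≢ 3 → Fibred i (φ (ρ x)) (φ (ρ y)) (φ (ρ z))
    ρ-fibred x y z e ≢3 with fibred x y z e
    ... | inj₁ (xy , yz , q) = outside (p z) refl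
      where
      outside : ∀ b → p z ≡ b → Fibred i (φ (ρ x)) (φ (ρ y)) (φ (ρ z))
      outside true pz = contradiction (cong₃ (λ a b d → toNat a + toNat b + toNat d)
        (trans (p-cong (trans xy yz)) pz) (trans (p-cong yz) pz) pz) ≢3
      outside false pz rewrite fix (trans (p-cong (trans xy yz)) pz) | fix (trans (p-cong yz) pz) | fix pz = inj₁ (xy , yz , q)
    ... | inj₂ (distinct , q) rewrite outer-ρ x | outer-ρ y | outer-ρ z = inj₂ (distinct , q)
    H-fibred : ∀ a b d → Edge H a b d → Fibred i (φ (σ a)) (φ (σ b)) (φ (σ d))
    H-fibred a b d e with x , y , z , e′ , ≢3 , ea , eb , ed ← σ-edge a b d e
      rewrite ea | eb | ed = ρ-fibred x y z e′ ≢3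

square-good : ∀ {N q} → Good N q → Good (N * N) (2 + q)
square-good {N} (c , good) = square , λ
  { zero G (φ , _ , mono) → layered⇒InUAny (V G) G ≤-refl (toℕ ∘ outer ∘ φ) λ x y z e →
      layered toℕ zero (λ _ ()) (λ s t _ → new-zero s t) (φ x) (φ y) (φ z) (mono x y z e)
  ; (suc zero) G (φ , _ , mono) → layered⇒InUAny (V G) G ≤-refl (toℕ ∘ opposite ∘ outer ∘ φ) λ x y z e →
      layered (toℕ ∘ opposite) (suc zero) (λ _ ()) (λ s t s≢t eq → opposite-< (new-one s t s≢t eq)) (φ x) (φ y) (φ z) (mono x y z e)
  ; (suc (suc i)) G (φ , φ-inj , mono) → fibred⇒InUAny i (good i) (V G) G ≤-refl φ φ-inj λ x y z e →
      square-old (φ x) (φ y) (φ z) i (mono x y z e) }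
  where
  open Square c
  opposite-< : ∀ {s t : Fin N} → t <ᶠ s → toℕ (opposite s) < toℕ (opposite t)
  opposite-< {s} {t} lt rewrite opposite-prop s | opposite-prop t = ∸-monoʳ-< (s≤s lt) (toℕ<n s)

star⇒InUAny : ∀ {N q} (c : Colouring N q) i s →
  (∀ a b d → a ≢ b × b ≢ d × a ≢ d → col c a b d ≡ i → ExactlyOne s a b d) → ∀ G → MonoCopy G c i → InUAny G
star⇒InUAny c i s star G (φ , φ-inj , mono) = 1 , InU.trans (tabulate (λ x → φ x == s) , λ x y z e →
  trans (meet-tabulate (λ x → φ x == s) x y z)
    (star (φ x) (φ y) (φ z) (edge-≢₁₂ G e ∘ φ-inj , edge-≢₂₃ G e ∘ φ-inj , edge-≢₁₃ G e ∘ φ-inj) (mono x y z e)))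

good₃ : Good 3 1
good₃ = c , λ { zero → star⇒InUAny c zero zero (λ a b d distinct _ → exactly-one₃ a b d distinct) }
  where
  c : Colouring 3 1
  c = record { col = λ _ _ _ → zero ; csym₁₂ = λ _ _ _ → refl ; csym₂₃ = λ _ _ _ → refl }

-- The triples through point 0 form a star, and the single triple left over is a star at any of its
-- points, here 1.
good₄ : Good 4 2
good₄ = c , λ { zero → star⇒InUAny c zero zero (from-yes (check zero zero))
              ; (suc zero) → star⇒InUAny c (suc zero) (suc zero) (from-yes (check (suc zero) (suc zero))) }
  where
  χ : Fin 4 → Fin 4 → Fin 4 → Fin 2
  χ a b d = if (a == zero) ∨ (b == zero) ∨ (d == zero) then zero else suc zero
  s₁₂ : Dec (∀ a b d → χ a b d ≡ χ b a d)
  s₁₂ = all? λ a → all? λ b → all? λ d → χ a b d ≟ χ b a d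
  s₂₃ : Dec (∀ a b d → χ a b d ≡ χ a d b)
  s₂₃ = all? λ a → all? λ b → all? λ d → χ a b d ≟ χ a d b
  c : Colouring 4 2
  c = record { col = χ ; csym₁₂ = from-yes s₁₂ ; csym₂₃ = from-yes s₂₃ }
  check : ∀ i s → Dec (∀ a b d → a ≢ b × b ≢ d × a ≢ d → χ a b d ≡ i → ExactlyOne s a b d)
  check i s = all? λ a → all? λ b → all? λ d → (¬? (a ≟ b) ×-dec ¬? (b ≟ d) ×-dec ¬? (a ≟ d)) →-dec
    ((χ a b d ≟ i) →-dec (toNat (a == s) + toNat (b == s) + toNat (d == s) ≟ⁿ 1))

tower-good : ∀ {b q} k → Good b q → Good (b ^ (2 ^ k)) (k * 2 + q)
tower-good {b} {q} zero    good = subst (λ n → Good n q) (sym (*-identityʳ b)) good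
tower-good {b} {q} (suc k) good = subst (λ n → Good n (suc k * 2 + q)) (begin
  b ^ (2 ^ k) * b ^ (2 ^ k) ≡⟨ sym (^-distribˡ-+-* b (2 ^ k) (2 ^ k)) ⟩
  b ^ (2 ^ k + 2 ^ k)       ≡⟨ cong (λ e → b ^ (2 ^ k + e)) (sym (+-identityʳ (2 ^ k))) ⟩
  b ^ (2 ^ suc k)           ∎) (square-good (tower-good k good))
  where open ≡-Reasoning

good⇒< : ∀ G {q M N} → ¬ InUAny G → Good M q → Arrows G q N → M < N
good⇒< G ¬U (c , good) arr = ≰⇒> λ N≤M → let i , copy = inject-arrows G N≤M arr c in ¬U (good i G copy)

square-cancel-≤ : ∀ x y → x * x ≤ y * y → x ≤ y
square-cancel-≤ x y le = ≮⇒≥ λ y<x → <⇒≱ (*-mono-< y<x y<x) le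

-- `√2 ≤ 3/2 ≤ log₂ 3` in integers, where the second inequality is `8 ≤ 9`.
2^-≤-3^ : ∀ p m → p * p ≤ 2 * (m * m) → 2 ^ p ≤ 3 ^ m
2^-≤-3^ p m le = square-cancel-≤ (2 ^ p) (3 ^ m) (begin
  2 ^ p * 2 ^ p        ≡⟨ sym (^-distribˡ-+-* 2 p p) ⟩
  2 ^ (p + p)          ≤⟨ ^-monoʳ-≤ 2 (square-cancel-≤ (p + p) (3 * m) 2p≤3m) ⟩
  2 ^ (3 * m)          ≡⟨ sym (^-*-assoc 2 3 m) ⟩
  8 ^ m                ≤⟨ ^-monoˡ-≤ m (n≤1+n 8) ⟩
  9 ^ m                ≡⟨ ^-*-assoc 3 2 m ⟩
  3 ^ (2 * m)          ≡⟨ cong (λ e → 3 ^ (m + e)) (+-identityʳ m) ⟩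
  3 ^ (m + m)          ≡⟨ ^-distribˡ-+-* 3 m m ⟩
  3 ^ m * 3 ^ m        ∎)
  where
  open ≤-Reasoning
  ring₁ : ∀ p → (p + p) * (p + p) ≡ 4 * (p * p)
  ring₁ = solve-∀
  ring₂ : ∀ m → 3 * m * (3 * m) ≡ 4 * (2 * (m * m)) + m * m
  ring₂ = solve-∀
  2p≤3m : (p + p) * (p + p) ≤ 3 * m * (3 * m)
  2p≤3m = begin
    (p + p) * (p + p)         ≡⟨ ring₁ p ⟩
    4 * (p * p)               ≤⟨ *-monoʳ-≤ 4 le ⟩
    4 * (2 * (m * m))         ≤⟨ m≤m+n _ (m * m) ⟩
    4 * (2 * (m * m)) + m * m ≡⟨ sym (ring₂ m) ⟩
    3 * m * (3 * m)           ∎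

parity : ∀ q → ∃ λ k → suc q ≡ k * 2 + 1 ⊎ suc q ≡ k * 2 + 2
parity zero          = 0 , inj₁ refl
parity (suc zero)    = 0 , inj₂ refl
parity (suc (suc q)) with parity q
... | k , inj₁ eq = suc k , inj₁ (cong (2 +_) eq)
... | k , inj₂ eq = suc k , inj₂ (cong (2 +_) eq)

-- The fractions `p / s` run through the rationals up to `2^(q/2)`, so this is `2^(2^(q/2)) ≤ N`
-- without real exponents.
DoubleExponential : ℕ → ℕ → Set
DoubleExponential q N = ∀ p s → 1 ≤ s → p * p ≤ 2 ^ q * (s * s) → 2 ^ p ≤ N ^ s

2^-double : ∀ k → 2 ^ (k * 2) ≡ 2 ^ k * 2 ^ k
2^-double k = trans (cong (2 ^_) (trans (*-comm k 2) (cong (k +_) (+-identityʳ k)))) (^-distribˡ-+-* 2 k k)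

double-exponential-lower-bound : ∀ G {q N} → ¬ InUAny G → 1 ≤ q → Arrows G q N → DoubleExponential q N
double-exponential-lower-bound G {suc q} {N} ¬U 1≤q arr p s _ le = cases (parity q) arr le
  where
  open ≤-Reasoning
  ring₁ : ∀ a s → a * a * 2 * (s * s) ≡ 2 * (a * s * (a * s))
  ring₁ = solve-∀
  ring₂ : ∀ a s → a * a * 4 * (s * s) ≡ 2 * (a * s) * (2 * (a * s))
  ring₂ = solve-∀
  cases : ∀ {q} → (∃ λ k → q ≡ k * 2 + 1 ⊎ q ≡ k * 2 + 2) → Arrows G q N → p * p ≤ 2 ^ q * (s * s) → 2 ^ p ≤ N ^ s
  -- Here `2^(q/2)` is `2^k * √2` and the colouring has `3^(2^k)` points, so `√2 ≤ log₂ 3` is what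
  -- is needed.
  cases (k , inj₁ refl) arr le = begin
    2 ^ p                 ≤⟨ 2^-≤-3^ p (2 ^ k * s) (≤-trans le (≤-reflexive (trans (cong (_* (s * s))
                               (trans (^-distribˡ-+-* 2 (k * 2) 1) (cong (_* 2) (2^-double k)))) (ring₁ (2 ^ k) s)))) ⟩
    3 ^ (2 ^ k * s)       ≡⟨ sym (^-*-assoc 3 (2 ^ k) s) ⟩
    (3 ^ (2 ^ k)) ^ s     ≤⟨ ^-monoˡ-≤ s (<⇒≤ (good⇒< G ¬U (tower-good k good₃) arr)) ⟩
    N ^ s                 ∎
  -- Here `2^(q/2)` is `2 * 2^k`, and `4^(2^k)` points match the bound exactly.
  cases (k , inj₂ refl) arr le = begin
    2 ^ p                 ≤⟨ ^-monoʳ-≤ 2 (square-cancel-≤ p (2 * (2 ^ k * s)) (≤-trans le (≤-reflexive (trans (cong (_* (s * s))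
                               (trans (^-distribˡ-+-* 2 (k * 2) 2) (cong (_* 4) (2^-double k)))) (ring₂ (2 ^ k) s))))) ⟩
    2 ^ (2 * (2 ^ k * s)) ≡⟨ sym (^-*-assoc 2 2 (2 ^ k * s)) ⟩
    4 ^ (2 ^ k * s)       ≡⟨ sym (^-*-assoc 4 (2 ^ k) s) ⟩
    (4 ^ (2 ^ k)) ^ s     ≤⟨ ^-monoˡ-≤ s (<⇒≤ (good⇒< G ¬U (tower-good k good₄) arr)) ⟩
    N ^ s                 ∎

theorem1p4 : (G : 3Graph) → AtLeastTwoEdges G →
    -- (a) tripartite: r(G;q) = q^Θ(1)
    (Tripartite G →
    Σ ℕ λ a → Σ ℕ λ b → Σ ℕ λ C → 1 ≤ a × 1 ≤ b ×
    RamseyEventually G (λ q N → q ^ a ≤ N ^ b × N ≤ q ^ C))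
    ×
    -- (b) G ∈ 𝒰 ∖ 𝒰_0
    (InUAny G → ¬ Tripartite G →
    (Σ ℕ λ a → Σ ℕ λ b → Σ ℕ λ C → 1 ≤ a × 1 ≤ b ×
    RamseyEventually G (λ q N → 2 ^ (a * q) ≤ N ^ b × N ≤ 2 ^ (q ^ C)))
    ×
    (∀ ℓ → InU ℓ G → Σ ℕ λ C →
    RamseyEventually G (λ q N → N ≤ 2 ^ (C * q ^ ℓ * log₂ q))))
    ×
    -- (c) G ∉ 𝒰
    (¬ InUAny G →
    Σ ℕ λ C →
    RamseyEventually G (λ q N →
    (∀ p s → 1 ≤ s → p * p ≤ 2 ^ q * (s * s) → 2 ^ p ≤ N ^ s)
    × N ≤ 2 ^ (2 ^ (C * q * log₂ q))))
theorem1p4 G two = part-a , (λ G∈U ¬tri → part-b G∈U ¬tri , part-b′ ¬tri) , part-c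
  where
  1≤V = ≤-trans (s≤s z≤n) (2≤V G two)
  1≤2 : 1 ≤ 2
  1≤2 = s≤s z≤n

  Bounded : (ℕ → ℕ) → (ℕ → ℕ → Set) → Set
  Bounded f L = RamseyEventually G (λ q N → L q N × N ≤ f q)

  -- `lower` asks only for `Arrows`, so it applies to whichever least number the search up to `f q`
  -- returns.
  bounded : ∀ {f} {L : ℕ → ℕ → Set} q₀ → (∀ q → q₀ ≤ q → 1 ≤ f q) → (∀ q → q₀ ≤ q → Arrows G q (f q)) →
    (∀ q N → q₀ ≤ q → Arrows G q N → L q N) → Bounded f L
  bounded {f} q₀ 1≤f arrows lower = q₀ , λ q q₀≤q →
    let N , isR@(_ , arr , _) , N≤ = ramsey-number-below G (f q) (1≤f q q₀≤q) (arrows q q₀≤q)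
    in N , isR , lower q N q₀≤q arr , N≤

  part-a : Tripartite G → Σ ℕ λ a → Σ ℕ λ b → Σ ℕ λ C → 1 ≤ a × 1 ≤ b × Bounded (λ q → q ^ C) (λ q N → q ^ a ≤ N ^ b)
  -- The threshold gives `V G ≤ q`, which `tripartite-size-bound` requires.
  part-a t = 1 , 10 , proj₁ size , ≤-refl , s≤s z≤n , bounded (2 ⊔ V G)
    (λ q le → 1≤^ (proj₁ size) (1≤ q le))
    (λ q le → tripartite-arrows G t 1≤V (1≤ q le) (proj₂ size q (m⊔n≤o⇒m≤o 2 (V G) le) (m⊔n≤o⇒n≤o 2 (V G) le)))
    (λ q N le → polynomial-lower-bound G two (1≤ q le))
    where
    size = tripartite-size-bound (V G)
    1≤ : ∀ q → 2 ⊔ V G ≤ q → 1 ≤ q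
    1≤ q le = ≤-trans 1≤2 (m⊔n≤o⇒m≤o 2 (V G) le)

  level-arrows : ∀ ℓ → InU (suc ℓ) G → ∃ λ C → ∀ q → 2 ≤ q → Arrows G q (2 ^ (C * q ^ suc ℓ * log₂ q))
  level-arrows ℓ G∈U = let C , arrows = off-diagonal ℓ (V G) in
    C , λ q 2≤q c → arrows q 2≤q (const G) (λ _ → ≤-refl) (λ _ → G∈U) c ≤-refl

  part-b : InUAny G → ¬ Tripartite G →
    Σ ℕ λ a → Σ ℕ λ b → Σ ℕ λ C → 1 ≤ a × 1 ≤ b × Bounded (λ q → 2 ^ (q ^ C)) (λ q N → 2 ^ (a * q) ≤ N ^ b)
  part-b (zero , tri t) ¬tri = contradiction t ¬tri
  -- `C ≤ q` and `log₂ q ≤ q` each add 1 to the power `suc ℓ` of `q`.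
  part-b (suc ℓ , G∈U) ¬tri = 1 , 9 , (1 + suc ℓ) + 1 , ≤-refl , s≤s z≤n , bounded (2 ⊔ C)
    (λ q _ → 1≤^ (q ^ ((1 + suc ℓ) + 1)) 1≤2)
    (λ q le → inject-arrows G (^-monoʳ-≤ 2 (exponent q (2≤ q le) (m⊔n≤o⇒n≤o 2 C le))) (arrows q (2≤ q le)))
    (λ q N le → exponential-lower-bound G ¬tri (≤-trans 1≤2 (2≤ q le)))
    where
    C = proj₁ (level-arrows ℓ G∈U)
    arrows = proj₂ (level-arrows ℓ G∈U)
    2≤ : ∀ q → 2 ⊔ C ≤ q → 2 ≤ q
    2≤ q le = m⊔n≤o⇒m≤o 2 C le
    exponent : ∀ q → 2 ≤ q → C ≤ q → C * q ^ suc ℓ * log₂ q ≤ q ^ ((1 + suc ℓ) + 1)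
    exponent q 2≤q C≤q = *-≤-^ q (1 + suc ℓ) 1
      (*-≤-^ q 1 (suc ℓ) (≤-trans C≤q (≤-reflexive (sym (^-identityʳ q)))) ≤-refl)
      (≤-trans (log₂≤ q (≤-trans 1≤2 2≤q)) (≤-reflexive (sym (^-identityʳ q))))

  part-b′ : ¬ Tripartite G → ∀ ℓ → InU ℓ G → Σ ℕ λ C → RamseyEventually G (λ q N → N ≤ 2 ^ (C * q ^ ℓ * log₂ q))
  part-b′ ¬tri zero (tri t) = contradiction t ¬tri
  part-b′ ¬tri (suc ℓ) G∈U = let C , arrows = level-arrows ℓ G∈U in
    C , 2 , λ q 2≤q → ramsey-number-below G _ (1≤^ (C * q ^ suc ℓ * log₂ q) 1≤2) (arrows q 2≤q)

  part-c : ¬ InUAny G → Σ ℕ λ C → Bounded (λ q → 2 ^ (2 ^ (C * q * log₂ q))) DoubleExponential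
  part-c ¬U = let C , size = clique-size-bound (V G) in
    C , bounded 2 (λ q _ → 1≤^ (2 ^ (C * q * log₂ q)) 1≤2)
      (λ q 2≤q → clique-arrows G (≤-trans 1≤2 2≤q) (size q 2≤q))
      (λ q N 2≤q → double-exponential-lower-bound G ¬U (≤-trans 1≤2 2≤q))
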